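{- Let $G$ be a $5$-regular graph on $n$ vertices that contains no clique on $6$ vertices ($K_6$) as a subgraph. Then $G$ has a path partition with at most $\frac{n}{6+\frac13}=\frac{3n}{19}$ components.
   Context: All graphs are finite, simple and undirected. A path partition of a graph $G=(V,E)$ is a set of vertex-disjoint paths of $G$ (a single vertex is allowed as a path) whose vertex sets together cover $V$; its members are called components. -}

module Defs where

open import Data.Fin.Base using (Fin)
open import Data.Fin.Properties using (_≟_)
open import Data.List.Base using (List; []; length; filter; allFin)
open import Data.List.Membership.Propositional using (_∈_)
open import Data.List.Relation.Binary.Disjoint.Propositional using (Disjoint)
open import Data.List.Relation.Unary.AllPairs using (AllPairs)
open import Data.List.Relation.Unary.Any using (Any)
open import Data.List.Relation.Unary.Linked using (Linked)
open import Data.List.Relation.Unary.Unique.Propositional using (Unique)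
open import Data.Nat.Base using (ℕ)
open import Function.Base using (_∘_)
open import Function.Definitions using (Injective)
open import Level using (0ℓ)
open import Relation.Binary.Core using (Rel)
open import Relation.Binary.Definitions using (Decidable; Symmetric)
open import Relation.Binary.PropositionalEquality using (_≡_; _≢_; refl; sym)
open import Relation.Nullary.Decidable using (¬?)
open import Relation.Nullary.Negation using (¬_)

-- Adjacency is required to be decidable because the graphs are finite
-- combinatorial objects; classically this is no restriction.
record Graph (n : ℕ) : Set₁ where
  field
    Adj      : Rel (Fin n) 0ℓ
    adj?     : Decidable Adj
    adj-sym  : Symmetric Adj
    loopless : ∀ v → ¬ Adj v v

open Graph public

neighbours : ∀ {n} → Graph n → Fin n → List (Fin n)
neighbours {n} G v = filter (adj? G v) (allFin n)

degree : ∀ {n} → Graph n → Fin n → ℕ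
degree G v = length (neighbours G v)

Regular : ∀ {n} → ℕ → Graph n → Set
Regular d G = ∀ v → degree G v ≡ d

complete : ∀ k → Graph k
complete k = record
  { Adj      = _≢_
  ; adj?     = λ u v → ¬? (u ≟ v)
  ; adj-sym  = λ u≢v → u≢v ∘ sym
  ; loopless = λ v v≢v → v≢v refl
  }

-- A copy of H as a (not necessarily induced) subgraph of G.
record Copy {k n} (H : Graph k) (G : Graph n) : Set where
  field
    embed     : Fin k → Fin n
    injective : Injective _≡_ _≡_ embed
    preserves : ∀ {i j} → Adj H i j → Adj G (embed i) (embed j)

-- A path is given by its vertices in order along the path; a path and its
-- reversal have the same vertex set, so the choice of direction is immaterial
-- to path partitions.
record Path {n} (G : Graph n) : Set where
  field
    vertices : List (Fin n)
    nonempty : vertices ≢ []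
    linked   : Linked (Adj G) vertices
    unique   : Unique vertices

open Path public

-- Since paths are nonempty, disjointness also rules out repetitions in the
-- list of components, so its length is the number of components.
record PathPartition {n} (G : Graph n) : Set where
  field
    components : List (Path G)
    disjoint   : AllPairs (λ P Q → Disjoint (vertices P) (vertices Q)) components
    covers     : ∀ v → Any (λ P → v ∈ vertices P) components

open PathPartition public

size : ∀ {n} {G : Graph n} → PathPartition G → ℕ
size 𝒫 = length (components 𝒫)

module Submission where

-- Take a path partition minimising a cost in which singletons are dear, cycles
-- (components whose last vertex is adjacent to the first) are cheap and any
-- merging of components pays off. Minimality gives: no two vertices at which
-- Hamiltonian paths of different components start are adjacent; two further
-- components cannot be attached to consecutive vertices of a path, one to
-- each half; and no singleton occurs, since the set of paths on three vertices
-- that can be exchanged with it would otherwise grow without end, 2k + 1 leaves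
-- of degree 5 being too many for k centres.
--
-- Now count 3 for each vertex, charge 19 to each component, and let the end
-- vertices x of a component pull a weight w x along each edge leaving it:
-- 2 for the two ends of an open path, 2 for every vertex of a cycle on at most
-- 3 vertices and 1 for every vertex of a longer cycle. A cycle on c vertices
-- gives nothing and pulls in at least w c (6 - c), which suffices except for
-- c = 6, where a K₆ is excluded. In an open path, receivers (vertices that
-- give) serve a single component if they are consecutive, and then give less;
-- a neighbour of the first vertex of the path never comes right after one, a
-- neighbour of the last vertex never right before one. Scanning along the path,
-- 3 per vertex is enough; receivers in every second position give equality,
-- which is where 19/3 comes from.

open import Defs
open import Data.Empty using (⊥; ⊥-elim)
open import Data.Fin.Base using (Fin; zero; suc)
open import Data.Fin.Properties using (_≟_)
open import Data.List.Base as List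
  using (List; []; _∷_; _++_; _∷ʳ_; length; map; filter; concat; lookup; reverse; allFin;
         cartesianProductWith; initLast; _∷ʳ′_)
open import Data.List.Membership.Propositional using (_∈_; _∉_; find; lose)
open import Data.List.Membership.Propositional.Properties
  using (∈-∃++; ∈-concat⁻′; ∈-concat⁺′; ∈-++⁺ˡ; ∈-++⁺ʳ; ∈-++⁻; ∈-lookup; ∈-map⁻; ∈-allFin;
         ∈-filter⁺; ∈-filter⁻; ∈-cartesianProductWith⁺)
open import Data.List.Properties
  using (unfold-reverse; length-++; length-map; length-tabulate; length-reverse; ++-assoc;
         concat-++; ≡-dec; ∷-injectiveˡ; ∷-injectiveʳ; reverse-++; map-++; concat-map-[_])
open import Data.List.Relation.Binary.Disjoint.Propositional using (Disjoint)
open import Data.List.Relation.Binary.Permutation.Propositional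
  using (_↭_; prep; swap; ↭-refl; ↭-sym; ↭-trans; ↭-reflexive; ↭⇒↭ₛ)
open import Data.List.Relation.Binary.Permutation.Propositional.Properties
  using (++⁺; ++⁺ˡ; ++⁺ʳ; ++-comm; ++-commutativeMonoid; map⁺; shift; shifts; ↭-reverse;
         ↭-length; All-resp-↭; ∈-resp-↭)
import Data.List.Relation.Binary.Permutation.Setoid.Properties as ↭ₛ
open import Data.List.Relation.Unary.All as All using (All; []; _∷_; all?)
open import Data.List.Relation.Unary.All.Properties using (¬Any⇒All¬; All¬⇒¬Any)
  renaming (++⁺ to All-++⁺; ++⁻ to All-++⁻; ++⁻ˡ to All-++⁻ˡ; ++⁻ʳ to All-++⁻ʳ)
open import Data.List.Relation.Unary.AllPairs using (AllPairs; []; _∷_)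
import Data.List.Relation.Unary.AllPairs.Properties as AllPairs
open import Data.List.Relation.Unary.Any using (here; there; any?)
import Data.List.Relation.Unary.Any.Properties as Any
open import Data.List.Relation.Unary.Linked using (Linked; linked?; [-]; _∷_)
open import Data.List.Relation.Unary.Unique.DecPropositional using (unique?)
open import Data.List.Relation.Unary.Unique.Propositional using (Unique)
open import Data.List.Relation.Unary.Unique.Propositional.Properties using (allFin⁺; filter⁺)
open import Data.Nat.Base
open import Data.Nat.Induction using (<-rec)
open import Data.Nat.ListAction using (sum)
open import Data.Nat.ListAction.Properties using (sum-++; sum-↭)
open import Data.Nat.Properties hiding (_≟_)
open import Data.Nat.Tactic.RingSolver using (solve-∀)
open import Data.Product.Base using (_×_; _,_; ∃; ∃₂; Σ-syntax; proj₁; proj₂)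
open import Data.Sum.Base using (_⊎_; inj₁; inj₂)
open import Function.Base using (_∘_; case_of_)
open import Level using (Level)
open import Relation.Binary.PropositionalEquality hiding ([_])
open import Relation.Nullary.Decidable using (Dec; yes; no; ¬?; _×-dec_; map′; decidable-stable)
open import Relation.Nullary.Negation using (¬_; contradiction)
open import Relation.Unary using (Pred; Decidable)

-- Indicators and sums over lists.

private
  variable
    ℓ : Level
    A B X Y : Set ℓ

-- Serves to add up hypotheses first and to cancel the surplus `c` afterwards; the two equations
-- carry the bookkeeping.
linear : ∀ {a b x y} c → a ≤ b → a ≡ x + c → b ≡ y + c → x ≤ y
linear {x = x} {y} c a≤b refl refl = +-cancelʳ-≤ c x y a≤b

𝟙 : Dec X → ℕ
𝟙 (yes _) = 1
𝟙 (no _)  = 0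

𝟙≤1 : (d : Dec X) → 𝟙 d ≤ 1
𝟙≤1 (yes _) = ≤-refl
𝟙≤1 (no _)  = z≤n

𝟙-yes : (d : Dec X) → X → 𝟙 d ≡ 1
𝟙-yes (yes _) p = refl
𝟙-yes (no ¬p) p = contradiction p ¬p

𝟙-no : (d : Dec X) → ¬ X → 𝟙 d ≡ 0
𝟙-no (yes p) ¬p = contradiction p ¬p
𝟙-no (no _)  ¬p = refl

𝟙-mono : (d : Dec X) (e : Dec Y) → (X → Y) → 𝟙 d ≤ 𝟙 e
𝟙-mono (yes p) e f = ≤-reflexive (sym (𝟙-yes e (f p)))
𝟙-mono (no _)  e f = z≤n

𝟙-cases : (d : Dec X) → (𝟙 d ≡ 0) ⊎ X
𝟙-cases (yes p) = inj₂ p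
𝟙-cases (no _)  = inj₁ refl

∑ : (A → ℕ) → List A → ℕ
∑ f xs = sum (map f xs)

∑-++ : (f : A → ℕ) (xs ys : List A) → ∑ f (xs ++ ys) ≡ ∑ f xs + ∑ f ys
∑-++ f xs ys = trans (cong sum (map-++ f xs ys)) (sum-++ (map f xs) (map f ys))

∑-↭ : (f : A → ℕ) {xs ys : List A} → xs ↭ ys → ∑ f xs ≡ ∑ f ys
∑-↭ f p = sum-↭ (map⁺ f p)

∑-mono : {f g : A → ℕ} (xs : List A) → (∀ {x} → x ∈ xs → f x ≤ g x) → ∑ f xs ≤ ∑ g xs
∑-mono []       h = z≤n
∑-mono (x ∷ xs) h = +-mono-≤ (h (here refl)) (∑-mono xs (h ∘ there))

∑-cong : {f g : A → ℕ} (xs : List A) → (∀ {x} → x ∈ xs → f x ≡ g x) → ∑ f xs ≡ ∑ g xs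
∑-cong []       h = refl
∑-cong (x ∷ xs) h = cong₂ _+_ (h (here refl)) (∑-cong xs (h ∘ there))

∑-const : (k : ℕ) (xs : List A) → ∑ (λ _ → k) xs ≡ length xs * k
∑-const k []       = refl
∑-const k (_ ∷ xs) = cong (k +_) (∑-const k xs)

∑-zero : {f : A → ℕ} (xs : List A) → (∀ {x} → x ∈ xs → f x ≡ 0) → ∑ f xs ≡ 0
∑-zero xs h = trans (∑-cong xs h) (trans (∑-const 0 xs) (*-zeroʳ (length xs)))

∑-+ : (f g : A → ℕ) (xs : List A) → ∑ (λ x → f x + g x) xs ≡ ∑ f xs + ∑ g xs
∑-+ f g []       = refl
∑-+ f g (x ∷ xs) rewrite ∑-+ f g xs = lem (f x) (g x) (∑ f xs) (∑ g xs)
  where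
  lem : ∀ a b c d → (a + b) + (c + d) ≡ (a + c) + (b + d)
  lem = solve-∀

∑-*ˡ : (k : ℕ) (f : A → ℕ) (xs : List A) → ∑ (λ x → k * f x) xs ≡ k * ∑ f xs
∑-*ˡ k f []       = sym (*-zeroʳ k)
∑-*ˡ k f (x ∷ xs) rewrite ∑-*ˡ k f xs = sym (*-distribˡ-+ k (f x) _)

∑-swap : (f : A → B → ℕ) (xs : List A) (ys : List B) →
  ∑ (λ x → ∑ (f x) ys) xs ≡ ∑ (λ y → ∑ (λ x → f x y) xs) ys
∑-swap f []       ys = sym (∑-zero ys (λ _ → refl))
∑-swap f (x ∷ xs) ys rewrite ∑-swap f xs ys = sym (∑-+ (f x) _ ys)

∑-concat : (f : A → ℕ) (xss : List (List A)) → ∑ f (concat xss) ≡ ∑ (∑ f) xss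
∑-concat f []         = refl
∑-concat f (xs ∷ xss) = trans (∑-++ f xs (concat xss)) (cong (∑ f xs +_) (∑-concat f xss))

∑-∈ : (f : A → ℕ) {x : A} {xs : List A} → x ∈ xs → f x ≤ ∑ f xs
∑-∈ f (here refl)            = m≤m+n _ _
∑-∈ f {xs = y ∷ _} (there p) = m≤n⇒m≤o+n (f y) (∑-∈ f p)

∑-pos : (f : A → ℕ) (xs : List A) → 0 < ∑ f xs → ∃ λ x → x ∈ xs × 0 < f x
∑-pos f (x ∷ xs) h with f x in eq
... | suc k = x , here refl , subst (0 <_) (sym eq) (s≤s z≤n)
... | zero  = let y , p , q = ∑-pos f xs h in y , there p , q

∑-length : (xss : List (List A)) → ∑ length xss ≡ length (concat xss)
∑-length []         = refl
∑-length (xs ∷ xss) = trans (cong (length xs +_) (∑-length xss)) (sym (length-++ xs))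

length-filter-∑ : {P : Pred A ℓ} (P? : Decidable P) (xs : List A) →
  length (filter P? xs) ≡ ∑ (λ x → 𝟙 (P? x)) xs
length-filter-∑ P? []       = refl
length-filter-∑ P? (x ∷ xs) with P? x
... | yes _ = cong suc (length-filter-∑ P? xs)
... | no _  = length-filter-∑ P? xs

-- Repetition-free lists, permutations and finite enumerations.

Unique-resp-↭ : {xs ys : List A} → xs ↭ ys → Unique xs → Unique ys
Unique-resp-↭ {A = A} p = ↭ₛ.Unique-resp-↭ (setoid A) (↭⇒↭ₛ p)

Unique-++ : (xs : List A) {ys : List A} → Unique (xs ++ ys) →
  Unique xs × Unique ys × (∀ {x} → x ∈ xs → x ∉ ys)
Unique-++ []       u = [] , u , λ ()
Unique-++ (x ∷ xs) (x∉ ∷ u) =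
  let uxs , uys , d = Unique-++ xs u in
  All-++⁻ˡ xs x∉ ∷ uxs , uys ,
  λ { (here refl) q → All¬⇒¬Any (All-++⁻ʳ xs x∉) q ; (there p) q → d p q }

Unique-⊆-length : {xs ys : List A} → Unique xs → (∀ {x} → x ∈ xs → x ∈ ys) → length xs ≤ length ys
Unique-⊆-length []        sub = z≤n
Unique-⊆-length {xs = x ∷ xs} (x∉ ∷ u) sub
  with as , bs , refl ← ∈-∃++ (sub (here refl)) =
  subst (suc (length xs) ≤_) (sym (↭-length (shift x as bs)))
    (s≤s (Unique-⊆-length u λ {y} p →
      case ∈-resp-↭ (shift x as bs) (sub (there p)) of λ where
        (here refl) → contradiction p (All¬⇒¬Any x∉)
        (there q)   → q))

Unique-∑≤1 : {P : Pred A ℓ} (P? : Decidable P) {xs : List A} → Unique xs →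
  (∀ {x y} → P x → P y → x ≡ y) → ∑ (λ x → 𝟙 (P? x)) xs ≤ 1
Unique-∑≤1 P? [] h = z≤n
Unique-∑≤1 P? {x ∷ xs} (x∉ ∷ u) h with P? x
... | no _  = Unique-∑≤1 P? u h
... | yes p = s≤s (≤-reflexive (∑-zero xs λ {y} y∈ →
  𝟙-no (P? y) λ q → All¬⇒¬Any x∉ (subst (_∈ xs) (h q p) y∈)))

concat-↭ : {xss yss : List (List A)} → xss ↭ yss → concat xss ↭ concat yss
concat-↭ _↭_.refl     = ↭-refl
concat-↭ (prep xs p)  = ++⁺ˡ xs (concat-↭ p)
concat-↭ (swap xs ys p) = ↭-trans (shifts xs ys) (++⁺ˡ ys (++⁺ˡ xs (concat-↭ p)))
concat-↭ (_↭_.trans p q)  = ↭-trans (concat-↭ p) (concat-↭ q)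

extract : {x : A} {xs : List A} → x ∈ xs → ∃ λ ys → xs ↭ x ∷ ys
extract x∈ with as , bs , refl ← ∈-∃++ x∈ = as ++ bs , shift _ as bs

∈-∷⁻ : {x y : A} {xs : List A} → y ≢ x → y ∈ x ∷ xs → y ∈ xs
∈-∷⁻ y≢x (here y≡x) = contradiction y≡x y≢x
∈-∷⁻ y≢x (there p)  = p

extract₂ : {x y : A} {xs : List A} → x ∈ xs → y ∈ xs → y ≢ x → ∃ λ zs → xs ↭ x ∷ y ∷ zs
extract₂ x∈ y∈ y≢x =
  let ys , p = extract x∈
      zs , q = extract (∈-∷⁻ y≢x (∈-resp-↭ p y∈))
  in zs , ↭-trans p (prep _ q)

extract₃ : {x y z : A} {xs : List A} → x ∈ xs → y ∈ xs → z ∈ xs → y ≢ x → z ≢ x → z ≢ y →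
  ∃ λ zs → xs ↭ x ∷ y ∷ z ∷ zs
extract₃ x∈ y∈ z∈ y≢x z≢x z≢y =
  let ys , p = extract₂ x∈ y∈ y≢x
      zs , q = extract (∈-∷⁻ z≢y (∈-∷⁻ z≢x (∈-resp-↭ p z∈)))
  in zs , ↭-trans p (prep _ (prep _ q))

listsUpTo : ℕ → List A → List (List A)
listsUpTo zero    as = [] ∷ []
listsUpTo (suc k) as = [] ∷ cartesianProductWith _∷_ as (listsUpTo k as)

∈-listsUpTo : ∀ {k} {as xs : List A} → length xs ≤ k → (∀ {x} → x ∈ xs → x ∈ as) → xs ∈ listsUpTo k as
∈-listsUpTo {k = zero}  {xs = []} _ _ = here refl
∈-listsUpTo {k = suc k} {xs = []} _ _ = here refl
∈-listsUpTo {k = suc k} {xs = x ∷ xs} (s≤s le) h =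
  there (∈-cartesianProductWith⁺ _∷_ (h (here refl)) (∈-listsUpTo le (h ∘ there)))

-- Meant for neighbour counts: the vertex itself, or one non-neighbour in the list, lowers the count
-- by one.
∑-miss : {A : Set} (f : A → ℕ) → (∀ x → f x ≤ 1) → ∀ {x xs} → x ∈ xs → f x ≡ 0 → suc (∑ f xs) ≤ length xs
∑-miss f f≤1 {xs = x ∷ xs} (here refl) fx rewrite fx = s≤s (≤-trans (∑-mono xs λ {y} _ → f≤1 y)
  (≤-reflexive (trans (∑-const 1 xs) (*-identityʳ (length xs)))))
∑-miss f f≤1 {xs = y ∷ xs} (there x∈) fx = ≤-trans (≤-reflexive (sym (+-suc (f y) _)))
  (+-mono-≤ (f≤1 y) (∑-miss f f≤1 x∈ fx))

Unique-lookup-injective : {A : Set} {xs : List A} → Unique xs → ∀ {i j} → lookup xs i ≡ lookup xs j → i ≡ j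
Unique-lookup-injective (x∉ ∷ u) {zero}  {zero}  eq = refl
Unique-lookup-injective (x∉ ∷ u) {zero}  {suc j} eq = contradiction eq (All.lookup x∉ (∈-lookup j))
Unique-lookup-injective (x∉ ∷ u) {suc i} {zero}  eq = contradiction (sym eq) (All.lookup x∉ (∈-lookup i))
Unique-lookup-injective (x∉ ∷ u) {suc i} {suc j} eq = cong suc (Unique-lookup-injective u eq)

clique-copy : ∀ {n} (G : Graph n) C → Unique C → (∀ {x y} → x ∈ C → y ∈ C → x ≢ y → Adj G x y) →
  Copy (complete (length C)) G
clique-copy G C u adjacent = record
  { embed     = lookup C
  ; injective = Unique-lookup-injective u
  ; preserves = λ {i} {j} i≢j → adjacent (∈-lookup i) (∈-lookup j) (i≢j ∘ Unique-lookup-injective u)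
  }

-- Walks, cycles and the cost of a component.

module Walks {n} (G : Graph n) where

  V : Set
  V = Fin n

  infix 4 _~_
  _~_ : V → V → Set
  _~_ = Adj G

  private
    variable
      u v w x y z : V
      p q c d : List V

  open import Algebra.Solver.CommutativeMonoid (++-commutativeMonoid {A = V}) public
    using (solve; _⊕_; _⊜_; id)

  data Walk : V → V → List V → Set where
    [_] : ∀ x → Walk x x (x ∷ [])
    _∷_ : x ~ y → Walk y z p → Walk x z (x ∷ p)

  infixr 5 _⟨_⟩_
  _⟨_⟩_ : Walk x y p → y ~ z → Walk z w q → Walk x w (p ++ q)
  [ x ]   ⟨ e ⟩ b = e ∷ b
  (f ∷ a) ⟨ e ⟩ b = f ∷ (a ⟨ e ⟩ b)

  reverseʷ : Walk x y p → Walk y x (reverse p)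
  reverseʷ [ x ] = [ x ]
  reverseʷ {x} {p = _ ∷ p} (e ∷ a) =
    subst (Walk _ _) (sym (unfold-reverse x p)) (reverseʷ a ⟨ adj-sym G e ⟩ [ x ])

  Walk-head : Walk x y (v ∷ p) → x ≡ v
  Walk-head [ x ]   = refl
  Walk-head (e ∷ a) = refl

  Walk-length : Walk x y p → 1 ≤ length p
  Walk-length [ x ]   = s≤s z≤n
  Walk-length (e ∷ a) = s≤s z≤n

  ++-length : Walk x y p → Walk z w q → 2 ≤ length (p ++ q)
  ++-length {p = p} a b = subst (2 ≤_) (sym (length-++ p)) (+-mono-≤ (Walk-length a) (Walk-length b))

  splitAt : ∀ p → Walk x y (p ++ v ∷ q) → Walk x v (p ∷ʳ v) × Walk v y (v ∷ q)
  splitAt []          [ x ]   = [ x ] , [ x ]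
  splitAt []          (e ∷ a) = [ _ ] , e ∷ a
  splitAt (_ ∷ [])    (e ∷ a) = let b , c = splitAt [] a in e ∷ b , c
  splitAt (_ ∷ _ ∷ p) (e ∷ a) = let b , c = splitAt (_ ∷ p) a in e ∷ b , c

  cut : ∀ p → Walk x y (p ++ u ∷ v ∷ q) → Walk x u (p ∷ʳ u) × u ~ v × Walk v y (v ∷ q)
  cut p a with splitAt p a
  ... | b , e ∷ c with refl ← Walk-head c = b , e , c

  before : ∀ p → Walk x y (p ++ v ∷ q) → p ≡ [] ⊎ ∃ λ u → Walk x u p × u ~ v
  before []           a       = inj₁ refl
  before (u ∷ [])     (e ∷ a) with refl ← Walk-head a = inj₂ (u , [ u ] , e)
  before (u ∷ u′ ∷ p) (e ∷ a) with refl ← Walk-head a with before (u′ ∷ p) a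
  ... | inj₂ (w , b , f) = inj₂ (w , e ∷ b , f)

  final : V → List V → V
  final x []       = x
  final x (y ∷ ys) = final y ys

  Walk-final : Walk x y (x ∷ p) → final x p ≡ y
  Walk-final [ x ] = refl
  Walk-final {p = z ∷ p} (e ∷ a) with refl ← Walk-head a = Walk-final a

  -- An edge counts as a cycle on two vertices, whereas a single vertex is never closed, since there
  -- are no loops.
  Closed : List V → Set
  Closed []       = ⊥
  Closed (x ∷ xs) = final x xs ~ x

  closed? : ∀ c → Dec (Closed c)
  closed? []       = no λ ()
  closed? (x ∷ xs) = adj? G (final x xs) x

  Walk-closed : Walk x y c → y ~ x → Closed c
  Walk-closed {c = _ ∷ _} a e with refl ← Walk-head a = subst (_~ _) (sym (Walk-final a)) e

  Closed-walk : Walk x y c → Closed c → y ~ x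
  Closed-walk {c = _ ∷ _} a e with refl ← Walk-head a = subst (_~ _) (Walk-final a) e

  -- Any merge of two components lowers the total cost, and so does every
  -- exchange that absorbs a singleton or turns an open path into a cycle.
  cost : List V → ℕ
  cost []              = 4
  cost (x ∷ [])        = 7
  cost c@(_ ∷ _ ∷ _)   = 5 ∸ 𝟙 (closed? c)

  -- The empty list is not a path; its cost is chosen so that this bound needs no hypothesis.
  4≤cost : ∀ c → 4 ≤ cost c
  4≤cost []            = ≤-refl
  4≤cost (x ∷ [])      = m≤m+n 4 3
  4≤cost c@(_ ∷ _ ∷ _) = ∸-monoʳ-≤ 5 (𝟙≤1 (closed? c))

  cost≤5 : 2 ≤ length c → cost c ≤ 5
  cost≤5 {c = x ∷ []} (s≤s ())
  cost≤5 {c = c@(_ ∷ _ ∷ _)} _ = m∸n≤m 5 (𝟙 (closed? c))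

  cost-++≤5 : Walk x y p → Walk z w q → cost (p ++ q) ≤ 5
  cost-++≤5 {p = p} {q = q} a b = cost≤5 {p ++ q} (++-length a b)

  cost-open : 2 ≤ length c → ¬ Closed c → cost c ≡ 5
  cost-open {c = x ∷ []} (s≤s ()) _
  cost-open {c = c@(_ ∷ _ ∷ _)} _ ¬cl = cong (5 ∸_) (𝟙-no (closed? c) ¬cl)

  cost-closed : 2 ≤ length c → Closed c → cost c ≡ 4
  cost-closed {c = x ∷ []} (s≤s ()) _
  cost-closed {c = c@(_ ∷ _ ∷ _)} _ cl = cong (5 ∸_) (𝟙-yes (closed? c) cl)

  IsPath : List V → Set
  IsPath c = ∃₂ λ x y → Walk x y c

  IsPartition : List (List V) → Set
  IsPartition css = All IsPath css × concat css ↭ allFin n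

  -- `x` starts a Hamiltonian path on the vertex set of `C`, which may differ from the list `C`
  -- itself.
  Endable : V → List V → Set
  Endable x C = ∃₂ λ y c → Walk x y c × c ↭ C

  -- The cycle is opened just before `x`.
  closed-endable : ∀ {a b} → Walk a b c → Closed c → x ∈ c → Endable x c
  closed-endable {c = c} {x = x} a cl x∈ with as , bs , refl ← ∈-∃++ x∈ with before as a
  ... | inj₁ refl with refl ← Walk-head a = _ , _ , a , ↭-refl
  ... | inj₂ (u , b , e) =
    u , _ , proj₂ (splitAt as a) ⟨ Closed-walk a cl ⟩ b ,
    solve 2 (λ s t → (t ⊕ s) ⊜ (s ⊕ t)) ↭-refl as (x ∷ bs)

  -- Exchange arguments in a partition of minimal cost.

  module Minimal (K : ℕ) (min : ∀ css → IsPartition css → K ≤ ∑ cost css) where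

    -- `K` is fixed while `css` varies, so that exchanges which keep the cost lead from one minimal
    -- partition to another.
    Optimal : List (List V) → Set
    Optimal css = IsPartition css × ∑ cost css ≤ K

    private
      variable
        css : List (List V)
        C D P : List V

    replace : IsPartition css → ∀ old new {rest} → css ↭ old ++ rest → All IsPath new →
      concat new ↭ concat old → IsPartition (new ++ rest)
    replace {css} (paths , cover) old new {rest} σ new-paths τ =
      All-++⁺ new-paths (proj₂ (All-++⁻ old (All-resp-↭ σ paths))) ,
      ↭-trans (↭-trans (↭-trans (↭-reflexive (sym (concat-++ new rest)))
        (↭-trans (++⁺ʳ (concat rest) τ) (↭-reflexive (concat-++ old rest))))
        (concat-↭ (↭-sym σ))) cover

    no-improvement : Optimal css → ∀ old new {rest} → css ↭ old ++ rest → All IsPath new →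
      concat new ↭ concat old → ∑ cost new < ∑ cost old → ⊥
    no-improvement {css} (part , ≤K) old new {rest} σ new-paths τ lt =
      <⇒≱ K>new (min _ (replace part old new σ new-paths τ))
      where
      open ≤-Reasoning
      K>new : ∑ cost (new ++ rest) < K
      K>new = begin-strict
        ∑ cost (new ++ rest)        ≡⟨ ∑-++ cost new rest ⟩
        ∑ cost new + ∑ cost rest    <⟨ +-monoˡ-< (∑ cost rest) lt ⟩
        ∑ cost old + ∑ cost rest    ≡⟨ ∑-++ cost old rest ⟨
        ∑ cost (old ++ rest)        ≡⟨ ∑-↭ cost σ ⟨
        ∑ cost css                  ≤⟨ ≤K ⟩
        K                           ∎

    -- The edge joins two Hamiltonian paths into one path, of cost at most 5 instead of at least 4 +
    -- 4.
    no-merge : Optimal css → C ∈ css → D ∈ css → D ≢ C → Endable x C → Endable y D → ¬ x ~ y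
    no-merge {C = C} {D} opt C∈ D∈ D≢C (_ , c , a , σ) (_ , d , b , τ) e =
      no-improvement opt (C ∷ D ∷ []) ((reverse c ++ d) ∷ []) (proj₂ (extract₂ C∈ D∈ D≢C))
        ((_ , _ , reverseʷ a ⟨ e ⟩ b) ∷ [])
        (↭-trans (++⁺ʳ [] (++⁺ (↭-trans (↭-reverse c) σ) τ)) (↭-reflexive (++-assoc C D [])))
        (≤-trans (s≤s (+-monoˡ-≤ 0 (cost-++≤5 (reverseʷ a) b)))
          (≤-trans (m≤m+n 6 2) (+-mono-≤ (4≤cost C) (+-monoˡ-≤ 0 (4≤cost D)))))

    -- The path is cut between u and v, and both halves absorb a component.
    no-double-merge : Optimal css → ∀ p → (p ++ u ∷ v ∷ q) ∈ css → C ∈ css → D ∈ css →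
      C ≢ (p ++ u ∷ v ∷ q) → D ≢ (p ++ u ∷ v ∷ q) → D ≢ C →
      Endable x C → Endable y D → x ~ u → ¬ y ~ v
    no-double-merge {u = u} {v} {q} {C} {D} opt@((paths , _) , _) p P∈ C∈ D∈ C≢P D≢P D≢C
      (_ , c , a , σ) (_ , d , b , τ) x~u y~v
      with _ , _ , w ← All.lookup paths P∈ with w₁ , _ , w₂ ← cut p w =
      no-improvement opt ((p ++ u ∷ v ∷ q) ∷ C ∷ D ∷ []) ((p ∷ʳ u ++ c) ∷ (reverse d ++ v ∷ q) ∷ [])
        (proj₂ (extract₃ P∈ C∈ D∈ C≢P D≢P D≢C))
        ((_ , _ , w₁ ⟨ adj-sym G x~u ⟩ a) ∷ (_ , _ , reverseʷ b ⟨ y~v ⟩ w₂) ∷ [])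
        (↭-trans (++⁺ (++⁺ˡ (p ∷ʳ u) σ) (++⁺ʳ [] (++⁺ʳ (v ∷ q) (↭-trans (↭-reverse d) τ))))
          (solve 5 (λ p u vq C D → (((p ⊕ u) ⊕ C) ⊕ ((D ⊕ vq) ⊕ id)) ⊜ ((p ⊕ (u ⊕ vq)) ⊕ (C ⊕ (D ⊕ id))))
            ↭-refl p (u ∷ []) (v ∷ q) C D))
        (≤-trans (s≤s (+-mono-≤ (cost-++≤5 w₁ a) (+-monoˡ-≤ 0 (cost-++≤5 (reverseʷ b) w₂))))
          (≤-trans (m≤m+n 11 1) (+-mono-≤ (4≤cost (p ++ u ∷ v ∷ q)) (+-mono-≤ (4≤cost C) (+-monoˡ-≤ 0 (4≤cost D))))))

    -- The edge from `u` to `v` is replaced by a detour through all of `C`, again at cost at most 5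
    -- instead of at least 8.
    no-insertion : Optimal css → ∀ p → (p ++ u ∷ v ∷ q) ∈ css → C ∈ css → C ≢ (p ++ u ∷ v ∷ q) →
      Walk x y c → c ↭ C → x ~ u → ¬ y ~ v
    no-insertion {u = u} {v} {q} {C} {c = c} opt@((paths , _) , _) p P∈ C∈ C≢P a σ x~u y~v
      with _ , _ , w ← All.lookup paths P∈ with w₁ , _ , w₂ ← cut p w =
      no-improvement opt ((p ++ u ∷ v ∷ q) ∷ C ∷ []) ((p ∷ʳ u ++ c ++ v ∷ q) ∷ [])
        (proj₂ (extract₂ P∈ C∈ C≢P))
        ((_ , _ , w₁ ⟨ adj-sym G x~u ⟩ (a ⟨ y~v ⟩ w₂)) ∷ [])
        (↭-trans (++⁺ʳ [] (++⁺ˡ (p ∷ʳ u) (++⁺ʳ (v ∷ q) σ)))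
          (solve 4 (λ p u vq C → (((p ⊕ u) ⊕ (C ⊕ vq)) ⊕ id) ⊜ ((p ⊕ (u ⊕ vq)) ⊕ (C ⊕ id)))
            ↭-refl p (u ∷ []) (v ∷ q) C))
        (≤-trans (s≤s (+-monoˡ-≤ 0 (cost-++≤5 w₁ (a ⟨ y~v ⟩ w₂))))
          (≤-trans (m≤m+n 6 2) (+-mono-≤ (4≤cost (p ++ u ∷ v ∷ q)) (+-monoˡ-≤ 0 (4≤cost C)))))

-- Disjointness of components and degree counts.

module Partitions {n} (G : Graph n) where
  open Walks G
  open import Data.List.Membership.DecPropositional (_≟_ {n}) public using (_∈?_)

  Walk-start∈ : ∀ {x y c} → Walk x y c → x ∈ c
  Walk-start∈ [ x ]   = here refl
  Walk-start∈ (e ∷ a) = here refl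

  Walk-end∈ : ∀ {x y c} → Walk x y c → y ∈ c
  Walk-end∈ [ x ]   = here refl
  Walk-end∈ (e ∷ a) = there (Walk-end∈ a)

  module _ {css : List (List V)} (part : IsPartition css) where

    partition-unique : Unique (concat css)
    partition-unique = Unique-resp-↭ (↭-sym (proj₂ part)) (allFin⁺ n)

    component-unique : ∀ {C} → C ∈ css → Unique C
    component-unique {C} C∈ =
      let _ , σ = extract C∈ in proj₁ (Unique-++ C (Unique-resp-↭ (concat-↭ σ) partition-unique))

    locate : ∀ v → ∃ λ C → v ∈ C × C ∈ css
    locate v = ∈-concat⁻′ css (∈-resp-↭ (↭-sym (proj₂ part)) (∈-allFin v))

    same-component : ∀ {C D v} → C ∈ css → D ∈ css → v ∈ C → v ∈ D → D ≡ C
    same-component {C} {D} C∈ D∈ v∈C v∈D = decidable-stable (≡-dec _≟_ D C) λ D≢C →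
      let _ , σ = extract₂ C∈ D∈ D≢C
          _ , _ , disj = Unique-++ C (Unique-resp-↭ (concat-↭ σ) partition-unique)
      in disj v∈C (∈-++⁺ˡ v∈D)

module Degrees {n} (G : Graph n) (regular : Regular 5 G) where
  open Walks G

  -- Together with `count≤5` this gives the double count of the edges between leaves `L` and centres
  -- `M`.
  5≤count : ∀ l (M : List V) → (∀ {m} → l ~ m → m ∈ M) → 5 ≤ ∑ (λ m → 𝟙 (adj? G l m)) M
  5≤count l M h = subst₂ _≤_ (regular l) (length-filter-∑ (adj? G l) M)
    (Unique-⊆-length (filter⁺ (adj? G l) (allFin⁺ n)) λ {x} x∈ →
      let _ , e = ∈-filter⁻ (adj? G l) {xs = allFin n} x∈ in ∈-filter⁺ (adj? G l) (h e) e)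

  count≤5 : ∀ m {L : List V} → Unique L → ∑ (λ l → 𝟙 (adj? G m l)) L ≤ 5
  count≤5 m {L} u = subst₂ _≤_ (length-filter-∑ (adj? G m) L) (regular m)
    (Unique-⊆-length (filter⁺ (adj? G m) u) λ {x} x∈ →
      ∈-filter⁺ (adj? G m) (∈-allFin x) (proj₂ (∈-filter⁻ (adj? G m) {xs = L} x∈)))

-- A minimal partition has no singletons.

module Singletons {n} (G : Graph n) (regular : Regular 5 G)
  (K : ℕ) (min : ∀ css → Walks.IsPartition G css → K ≤ ∑ (Walks.cost G) css) where

  open Walks G
  open Minimal K min
  open Partitions G
  open Degrees G regular

  Optimal-resp-↭ : ∀ {css dss} → css ↭ dss → Optimal css → Optimal dss
  Optimal-resp-↭ σ ((paths , cover) , ≤K) =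
    (All-resp-↭ σ paths , ↭-trans (concat-↭ (↭-sym σ)) cover) , subst (_≤ K) (∑-↭ cost σ) ≤K

  -- By `no-merge`, no Hamiltonian path on `Q` starts at `m`. A side of `m` with two or more
  -- vertices could be cut off and `l` attached to `m` instead: two components of cost at most 5
  -- would replace costs 7 and at least 4.
  singleton-neighbour : ∀ {css l m Q} → Optimal css → (l ∷ []) ∈ css → Q ∈ css → m ∈ Q → l ~ m →
    ∃₂ λ u v → Q ≡ u ∷ m ∷ v ∷ [] × ¬ Closed Q
  singleton-neighbour {css} {l} {m} {Q} opt l∈ Q∈ m∈Q e =
    let as , bs , Q≡ = ∈-∃++ m∈Q ; _ , _ , w = All.lookup (proj₁ (proj₁ opt)) Q∈ in go as bs Q≡ w
    where
    Q≢ : Q ≢ l ∷ []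
    Q≢ eq = case subst (m ∈_) eq m∈Q of λ { (here refl) → loopless G l e }

    m-not-endable : ¬ Endable m Q
    m-not-endable me = no-merge opt l∈ Q∈ Q≢ (_ , _ , [ l ] , ↭-refl) me e

    exchange : ∀ new → All IsPath new → concat new ↭ l ∷ Q → ∑ cost new ≤ 10 → ⊥
    exchange new paths σ le = no-improvement opt ((l ∷ []) ∷ Q ∷ []) new
      (proj₂ (extract₂ l∈ Q∈ Q≢)) paths (↭-trans σ (prep l (solve 1 (λ q → q ⊜ (q ⊕ id)) ↭-refl Q)))
      (≤-trans (s≤s le) (+-monoʳ-≤ 7 (+-monoˡ-≤ 0 (4≤cost Q))))

    go : ∀ as bs → Q ≡ as ++ m ∷ bs → ∀ {x y} → Walk x y Q →
      ∃₂ λ u v → Q ≡ u ∷ m ∷ v ∷ [] × ¬ Closed Q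
    go [] bs refl w with refl ← Walk-head w = ⊥-elim (m-not-endable (_ , _ , w , ↭-refl))
    go as [] refl w with splitAt as w
    ... | _ , [ _ ] = ⊥-elim (m-not-endable (_ , _ , reverseʷ w , ↭-reverse _))
    go (u ∷ []) (v ∷ []) refl w = u , v , refl , λ cl →
      m-not-endable (closed-endable w cl (there (here refl)))
    go (u ∷ []) (v ∷ v′ ∷ bs) refl (f ∷ g ∷ h ∷ w) with refl ← Walk-head w = ⊥-elim (exchange
      ((u ∷ m ∷ l ∷ []) ∷ (v ∷ v′ ∷ bs) ∷ [])
      ((_ , _ , f ∷ adj-sym G e ∷ [ l ]) ∷ (_ , _ , h ∷ w) ∷ [])
      (solve 4 (λ u m l vs → ((u ⊕ (m ⊕ l)) ⊕ (vs ⊕ id)) ⊜ (l ⊕ (u ⊕ (m ⊕ vs)))) ↭-refl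
        (u ∷ []) (m ∷ []) (l ∷ []) (v ∷ v′ ∷ bs))
      (+-mono-≤ (cost≤5 {u ∷ m ∷ l ∷ []} (s≤s (s≤s z≤n)))
        (+-monoˡ-≤ 0 (cost≤5 {v ∷ v′ ∷ bs} (s≤s (s≤s z≤n))))))
    go as@(u ∷ u′ ∷ as′) bs@(_ ∷ _) refl w with before as w
    ... | inj₂ (_ , w₁ , _) = ⊥-elim (exchange
      ((l ∷ m ∷ bs) ∷ as ∷ [])
      ((_ , _ , e ∷ proj₂ (splitAt as w)) ∷ (_ , _ , w₁) ∷ [])
      (solve 3 (λ l mbs as → ((l ⊕ mbs) ⊕ (as ⊕ id)) ⊜ (l ⊕ (as ⊕ mbs))) ↭-refl (l ∷ []) (m ∷ bs) as)
      (+-mono-≤ (cost≤5 {l ∷ m ∷ bs} (s≤s (s≤s z≤n))) (+-monoˡ-≤ 0 (cost≤5 {as} (s≤s (s≤s z≤n))))))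

  Centred : List V → List V → Set
  Centred M F = ∃ λ m → (∃₂ λ u v → F ≡ u ∷ m ∷ v ∷ []) × m ∈ M

  -- Only `Fs` may depend on `l`; `rest` is shared by all leaves, so that one of its paths can be
  -- reassigned for all of them at once.
  Exchangeable : List (List V) → List V → V → Set
  Exchangeable rest M l = ∃ λ Fs → All (Centred M) Fs × Optimal ((l ∷ []) ∷ Fs ++ rest)

  -- Since L has more vertices than 5-regularity lets M absorb, some vertex
  -- of L has a neighbour outside M; that neighbour is the centre of a path
  -- on three vertices in rest, which can be added to the structure.
  no-exchangeable : ∀ k rest M L → length rest ≤ k → length L ≡ 1 + 2 * length M → Unique L →
    ¬ (∀ {l} → l ∈ L → Exchangeable rest M l)
  no-exchangeable k rest M L ≤k size uniqueL exch =
    case any? (λ l → any? (λ m → adj? G l m ×-dec ¬? (m ∈? M)) (allFin n)) L of λ where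
      (no none)  → too-many λ {l} l∈ {m} e → decidable-stable (m ∈? M) λ m∉ →
        none (lose l∈ (lose (∈-allFin m) (e , m∉)))
      (yes some) → let l , l∈ , some′ = find some ; m , _ , e , m∉ = find some′ in grow l∈ e m∉
    where
    -- All five edges at each of the 2k + 1 leaves would end in the k centres, which have room for
    -- 5k edges only.
    too-many : ¬ (∀ {l} → l ∈ L → ∀ {m} → l ~ m → m ∈ M)
    too-many closed = <⇒≱ lt (begin
      length L * 5                                  ≡⟨ ∑-const 5 L ⟨
      ∑ (λ _ → 5) L                                 ≤⟨ ∑-mono L (λ {l} l∈ → 5≤count l M (closed l∈)) ⟩
      ∑ (λ l → ∑ (λ m → 𝟙 (adj? G l m)) M) L       ≡⟨ ∑-swap (λ l m → 𝟙 (adj? G l m)) L M ⟩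
      ∑ (λ m → ∑ (λ l → 𝟙 (adj? G l m)) L) M       ≤⟨ ∑-mono M (λ {m} _ → ≤-trans
                                                         (∑-mono L λ {l} _ → 𝟙-mono (adj? G l m) (adj? G m l) (adj-sym G))
                                                         (count≤5 m uniqueL)) ⟩
      ∑ (λ _ → 5) M                                 ≡⟨ ∑-const 5 M ⟩
      length M * 5                                  ∎)
      where
      open ≤-Reasoning
      lt : length M * 5 < length L * 5
      lt = *-monoˡ-< 5 (subst (length M <_) (sym size) (s≤s (m≤m+n (length M) _)))

    grow : ∀ {l m} → l ∈ L → l ~ m → m ∉ M → ⊥
    grow {l} {m} l∈ e m∉
      with Fs , centred , opt ← exch l∈
      with Q , m∈Q , Q∈ ← locate (proj₁ opt) m
      with u , v , refl , ¬cl ← singleton-neighbour opt (here refl) Q∈ m∈Q e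
      with ∈-++⁻ Fs (∈-∷⁻ (λ ()) Q∈)
    -- A path of `Fs` has its middle vertex in `M`, and `m` is the middle vertex of `Q`.
    ... | inj₁ Q∈Fs with _ , (_ , _ , refl) , m∈M ← All.lookup centred Q∈Fs = m∉ m∈M
    ... | inj₂ Q∈rest = extend k ≤k
      where
      Q′ : List V
      Q′ = u ∷ m ∷ v ∷ []

      rest′ : List (List V)
      rest′ = proj₁ (extract Q∈rest)

      σ : rest ↭ Q′ ∷ rest′
      σ = proj₂ (extract Q∈rest)

      pull : ∀ {l Fs} → (l ∷ []) ∷ Fs ++ rest ↭ (l ∷ []) ∷ Q′ ∷ Fs ++ rest′
      pull {l} {Fs} = prep (l ∷ []) (↭-trans (++⁺ˡ Fs σ) (shift Q′ Fs rest′))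

      -- A leaf on `Q′` would be a singleton in a partition that also contains `Q′`.
      fresh : ∀ {x} → x ∈ Q′ → x ∉ L
      fresh x∈Q x∈L =
        let Fs , _ , opt = exch x∈L in
        case same-component (proj₁ opt) (here refl) (there (∈-++⁺ʳ Fs Q∈rest)) (here refl) x∈Q of λ ()

      uniqueQ : Unique Q′
      uniqueQ = component-unique (proj₁ opt) Q∈

      l~ : IsPath Q′
      l~ = All.lookup (proj₁ (proj₁ opt)) Q∈

      edges : ∀ {x y} → Walk x y Q′ → u ~ m × m ~ v
      edges (f ∷ g ∷ [ _ ]) = f , g

      u~m = proj₁ (edges (proj₂ (proj₂ l~)))
      m~v = proj₂ (edges (proj₂ (proj₂ l~)))

      -- `l` takes the place of the end `x` of `Q′`. The cost does not rise, because `Q′` is open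
      -- and already costs 5.
      switch : ∀ {x a b} → a ~ m → m ~ b → x ∷ a ∷ m ∷ b ∷ [] ↭ l ∷ Q′ →
        Exchangeable rest′ (m ∷ M) x
      switch {x} {a} {b} f g τ = (a ∷ m ∷ b ∷ []) ∷ Fs ,
        (m , (_ , _ , refl) , here refl) ∷ All.map (λ (c , s , c∈) → c , s , there c∈) centred ,
        replace (proj₁ opt) ((l ∷ []) ∷ Q′ ∷ []) ((x ∷ []) ∷ (a ∷ m ∷ b ∷ []) ∷ []) (pull {l} {Fs})
          ((_ , _ , [ x ]) ∷ (_ , _ , f ∷ g ∷ [ b ]) ∷ []) τ ,
        ≤-trans (+-monoʳ-≤ 7 (+-monoˡ-≤ _ (≤-trans (cost≤5 {a ∷ m ∷ b ∷ []} (s≤s (s≤s z≤n)))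
          (≤-reflexive (sym (cost-open {Q′} (s≤s (s≤s z≤n)) ¬cl))))))
          (proj₂ (Optimal-resp-↭ (pull {l} {Fs}) opt))

      exch′ : ∀ {x} → x ∈ u ∷ v ∷ L → Exchangeable rest′ (m ∷ M) x
      exch′ (here refl) = switch e m~v (swap _ _ ↭-refl)
      exch′ (there (here refl)) = switch u~m (adj-sym G e)
        (solve 4 (λ v u m l → (v ⊕ (u ⊕ (m ⊕ l))) ⊜ (l ⊕ (u ⊕ (m ⊕ v)))) ↭-refl
          (v ∷ []) (u ∷ []) (m ∷ []) (l ∷ []))
      -- An old leaf keeps its partition; `Q′` merely moves from `rest` to the paths with known
      -- centre.
      exch′ (there (there x∈)) =
        let Fs′ , centred′ , opt′ = exch x∈ in
        Q′ ∷ Fs′ , (m , (_ , _ , refl) , here refl) ∷ All.map (λ (c , s , c∈) → c , s , there c∈) centred′ ,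
        Optimal-resp-↭ (pull {_} {Fs′}) opt′

      uniqueL′ : Unique (u ∷ v ∷ L)
      uniqueL′ with (_ ∷ u≢v ∷ []) ∷ _ ← uniqueQ =
        (u≢v ∷ ¬Any⇒All¬ L (fresh (here refl))) ∷ ¬Any⇒All¬ L (fresh (there (there (here refl)))) ∷ uniqueL

      extend : ∀ k → length rest ≤ k → ⊥
      extend zero    le with () ← subst (_≤ 0) (↭-length σ) le
      -- One more centre and two more leaves preserve the relation of sizes, while `rest` loses a
      -- path.
      extend (suc k) le = no-exchangeable k rest′ (m ∷ M) (u ∷ v ∷ L)
        (s≤s⁻¹ (subst (_≤ suc k) (↭-length σ) le)) (trans (cong (2 +_) size) (lem (length M))) uniqueL′ exch′
        where
        lem : ∀ a → 2 + (1 + 2 * a) ≡ 1 + 2 * (1 + a)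
        lem = solve-∀

  no-singleton : ∀ {css x} → Optimal css → (x ∷ []) ∉ css
  no-singleton {x = x} opt x∈ =
    let rest , σ = extract x∈ in
    no-exchangeable (length rest) rest [] (x ∷ []) ≤-refl refl ([] ∷ [])
      λ { (here refl) → [] , [] , Optimal-resp-↭ σ opt }

  2≤component : ∀ {css C} → Optimal css → C ∈ css → 2 ≤ length C
  2≤component {C = []} opt C∈ with _ , _ , () ← All.lookup (proj₁ (proj₁ opt)) C∈
  2≤component {C = x ∷ []} opt C∈ = ⊥-elim (no-singleton opt C∈)
  2≤component {C = _ ∷ _ ∷ _} opt C∈ = s≤s (s≤s z≤n)

-- Scanning a path with 3 per vertex.

-- Every element of the list earns 3. The three bounds are on the credit
-- left after a non-receiver, after the last element of a block of receivers
-- and inside such a block.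
module Scan {A : Set} (r α β : A → ℕ) where

  -- `r` will be what a vertex gives, while `α` and `β` mark neighbours of the first and the last
  -- vertex of the path. An edge marked in this way stays inside the path and so fails to pull in a
  -- weight 2, whence the factor.
  load : A → ℕ
  load v = r v + 2 * (α v + β v)

  -- For consecutive vertices of an open path, `back` and `forth` will come from rotating the path,
  -- `cross` from closing it to a cycle, and `run` from two consecutive receivers serving one
  -- component.
  record Step (u v : A) : Set where
    field
      back  : α v ≡ 0 ⊎ r u ≡ 0
      forth : β u ≡ 0 ⊎ r v ≡ 0
      cross : α v ≡ 0 ⊎ β u ≡ 0
      bound : 0 < r v → load v ≤ 6
      run   : 0 < r u → 0 < r v → load u ≤ 3 + (α u + β u) × load v ≤ 3 + (α v + β v)

  Chain : A → List A → Set
  Chain u []       = r u ≡ 0 × β u ≡ 0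
  Chain u (v ∷ vs) = Step u v × Chain v vs

  private
    pos-or-zero : ∀ k → k ≡ 0 ⊎ 0 < k
    pos-or-zero zero    = inj₁ refl
    pos-or-zero (suc k) = inj₂ (s≤s z≤n)

    pos⇒zero : ∀ {P : Set} {k} → 0 < k → P ⊎ k ≡ 0 → P
    pos⇒zero p  (inj₁ q)    = q
    pos⇒zero () (inj₂ refl)

    pos⇒zero′ : ∀ {k l} → 0 < l → k ≡ 0 ⊎ l ≡ 0 → k ≡ 0
    pos⇒zero′ = pos⇒zero

    -- Credit is computed from the end of the list: a vertex of load `l` turns the credit `a` of the
    -- tail into the credit `b`.
    earn : ∀ a b l {s} k → l + b ≤ 3 + a → a + s ≤ 3 * k → b + (l + s) ≤ 3 * suc k
    earn a b l {s} k p q = linear a (+-mono-≤ p q) (lem₁ l b a s) (lem₂ a k)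
      where
      lem₁ : ∀ l b a s → l + b + (a + s) ≡ b + (l + s) + a
      lem₁ = solve-∀
      lem₂ : ∀ a k → 3 + a + 3 * k ≡ 3 * suc k + a
      lem₂ = solve-∀

  module _ (α≤1 : ∀ v → α v ≤ 1) (β≤1 : ∀ v → β v ≤ 1) where

    open Step

    after-gap   : ∀ u vs → r u ≡ 0 → Chain u vs → 2 * β u + ∑ load vs ≤ 3 * length vs
    after-block : ∀ u v vs → 0 < r u → r v ≡ 0 → Chain u (v ∷ vs) → 3 + ∑ load (v ∷ vs) ≤ 3 * length (v ∷ vs)
    in-block    : ∀ u v vs → 0 < r u → 0 < r v → Chain u (v ∷ vs) → 1 + ∑ load (v ∷ vs) ≤ 3 * length (v ∷ vs)

    after-gap u [] ru c = ≤-reflexive (cong (λ k → 2 * k + 0) (proj₂ c))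
    after-gap u (v ∷ vs) ru (s , c) with pos-or-zero (r v)
    -- By `cross`, the reserve 2 for `β u` and the charge 2 for `α v` never occur together, so 3
    -- covers whichever is present.
    ... | inj₁ rv = earn (2 * β v) (2 * β u) (load v) (length vs) (bnd (cross s)) (after-gap v vs rv c)
      where
      bnd : α v ≡ 0 ⊎ β u ≡ 0 → load v + 2 * β u ≤ 3 + 2 * β v
      bnd (inj₁ αv) rewrite rv | αv = ≤-trans (+-monoʳ-≤ (2 * β v) (*-monoʳ-≤ 2 (β≤1 u)))
        (≤-trans (≤-reflexive (+-comm (2 * β v) 2)) (n≤1+n _))
      bnd (inj₂ βu) rewrite rv | βu = ≤-trans (≤-reflexive (lem (α v) (β v)))
        (+-monoˡ-≤ (2 * β v) (≤-trans (*-monoʳ-≤ 2 (α≤1 v)) (n≤1+n 2)))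
        where
        lem : ∀ a b → 2 * (a + b) + 0 ≡ 2 * a + 2 * b
        lem = solve-∀
    after-gap u (v ∷ []) ru (s , c) | inj₂ rv = contradiction (proj₁ c) (>⇒≢ rv)
    after-gap u (v ∷ w ∷ ws) ru (s , c) | inj₂ rv rewrite pos⇒zero′ rv (forth s) with pos-or-zero (r w)
    -- An isolated receiver may carry 6: its own 3 and the 3 saved right after the block. This is
    -- the tight case.
    ... | inj₁ rw = earn 3 0 (load v) (suc (length ws)) (subst (_≤ 6) (sym (+-identityʳ (load v))) (bound s rv))
                      (after-block v w ws rv rw c)
    -- In a longer block `β v` vanishes because `w` receives as well, so the load of `v` is at most
    -- 4.
    ... | inj₂ rw = earn 1 0 (load v) (suc (length ws)) bnd (in-block v w ws rv rw c)
      where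
      bnd : load v + 0 ≤ 4
      bnd = ≤-trans (≤-reflexive (+-identityʳ (load v)))
        (≤-trans (proj₁ (run (proj₁ c) rv rw))
          (+-monoʳ-≤ 3 (subst (λ k → α v + k ≤ 1) (sym (pos⇒zero′ rw (forth (proj₁ c))))
            (≤-trans (≤-reflexive (+-identityʳ (α v))) (α≤1 v)))))

    after-block u v vs ru rv (s , c) = earn (2 * β v) 3 (load v) (length vs) bnd (after-gap v vs rv c)
      where
      bnd : load v + 3 ≤ 3 + 2 * β v
      -- Right after a receiver `α v` vanishes, and the remaining load is just the credit of the
      -- tail.
      bnd rewrite rv | pos⇒zero′ ru (back s) = ≤-reflexive (+-comm (2 * β v) 3)

    in-block u v [] ru rv (s , c) = contradiction (proj₁ c) (>⇒≢ rv)
    in-block u v (w ∷ ws) ru rv (s , c) with pos-or-zero (r w)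
    ... | inj₁ rw = earn 3 1 (load v) (suc (length ws)) bnd (after-block v w ws rv rw c)
      where
      bnd : load v + 1 ≤ 6
      bnd = ≤-trans (+-monoˡ-≤ 1 (≤-trans (proj₂ (run s ru rv))
        (+-monoʳ-≤ 3 (subst (λ k → k + β v ≤ 1) (sym (pos⇒zero′ ru (back s))) (β≤1 v))))) (n≤1+n 5)
    ... | inj₂ rw = earn 1 1 (load v) (suc (length ws)) bnd (in-block v w ws rv rw c)
      where
      bnd : load v + 1 ≤ 4
      bnd = +-monoˡ-≤ 1 (subst₂ (λ j k → load v ≤ 3 + (j + k))
        (pos⇒zero′ ru (back s)) (pos⇒zero′ rw (forth (proj₁ c))) (proj₂ (run s ru rv)))

-- Weights and their transfer along edges between components.

module Discharging {n} (G : Graph n) (regular : Regular 5 G) (noK₆ : ¬ Copy (complete 6) G)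
  (K : ℕ) (min : ∀ css → Walks.IsPartition G css → K ≤ ∑ (Walks.cost G) css)
  (css : List (List (Fin n))) (opt : Walks.Minimal.Optimal G K min css) where

  open Walks G
  open Minimal K min
  open Partitions G
  open Singletons G regular K min

  part : IsPartition css
  part = proj₁ opt

  component : V → List V
  component v = proj₁ (locate part v)

  ∈component : ∀ v → v ∈ component v
  ∈component v = proj₁ (proj₂ (locate part v))

  component∈ : ∀ v → component v ∈ css
  component∈ v = proj₂ (proj₂ (locate part v))

  component≡ : ∀ {C v} → C ∈ css → v ∈ C → component v ≡ C
  component≡ {v = v} C∈ v∈ = same-component part C∈ (component∈ v) v∈ (∈component v)

  walk : ∀ {C} → C ∈ css → IsPath C
  walk C∈ = All.lookup (proj₁ part) C∈

  ends : List V → List V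
  ends []       = []
  ends (x ∷ xs) = x ∷ final x xs ∷ []

  weight : List V → V → ℕ
  weight C x with closed? C | length C ≤? 3
  ... | yes _ | yes _ = 2
  ... | yes _ | no _  = 1
  ... | no _  | _     = 2 * 𝟙 (x ∈? ends C)

  weight≤2 : ∀ C x → weight C x ≤ 2
  weight≤2 C x with closed? C | length C ≤? 3
  ... | yes _ | yes _ = ≤-refl
  ... | yes _ | no _  = n≤1+n 1
  ... | no _  | _     = *-monoʳ-≤ 2 (𝟙≤1 (x ∈? ends C))

  weight-long : ∀ C x → Closed C → 3 < length C → weight C x ≡ 1
  weight-long C x cl lt with closed? C | length C ≤? 3
  ... | yes _ | yes le = contradiction le (<⇒≱ lt)
  ... | yes _ | no _   = refl
  ... | no ¬cl | _     = contradiction cl ¬cl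

  weight-short : ∀ C x → Closed C → length C ≤ 3 → weight C x ≡ 2
  weight-short C x cl le with closed? C | length C ≤? 3
  ... | yes _ | yes _ = refl
  ... | yes _ | no nle = contradiction le nle
  ... | no ¬cl | _     = contradiction cl ¬cl

  weight-open : ∀ C x → ¬ Closed C → weight C x ≡ 2 * 𝟙 (x ∈? ends C)
  weight-open C x ¬cl with closed? C | length C ≤? 3
  ... | yes cl | _    = contradiction cl ¬cl
  ... | no _   | _    = refl

  ends-walk : ∀ {a b C} → Walk a b C → ends C ≡ a ∷ b ∷ []
  ends-walk {C = _ ∷ _} a with refl ← Walk-head a = cong (λ b → _ ∷ b ∷ []) (Walk-final a)

  weight-end : ∀ {a b C x} → Walk a b C → ¬ Closed C → 0 < weight C x → x ≡ a ⊎ x ≡ b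
  weight-end {C = C} {x} a ¬cl pos with x ∈? ends C | weight-open C x ¬cl
  ... | no _   | eq = contradiction eq (>⇒≢ pos)
  ... | yes x∈ | _  with subst (x ∈_) (ends-walk a) x∈
  ... | here eq         = inj₁ eq
  ... | there (here eq) = inj₂ eq

  weight-endable : ∀ {C x} → C ∈ css → x ∈ C → 0 < weight C x → Endable x C
  weight-endable {C} {x} C∈ x∈ pos = endable (closed? C)
    where
    a : Walk _ _ C
    a = proj₂ (proj₂ (walk C∈))
    endable : Dec (Closed C) → Endable x C
    endable (yes cl) = closed-endable a cl x∈
    endable (no ¬cl) with weight-end a ¬cl pos
    ... | inj₁ refl = _ , _ , a , ↭-refl
    ... | inj₂ refl = _ , _ , reverseʷ a , ↭-reverse _

  w : V → ℕ
  w x = weight (component x) x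

  Leaves : V → V → Set
  Leaves x v = x ~ v × v ∉ component x

  leaves? : ∀ x v → Dec (Leaves x v)
  leaves? x v = adj? G x v ×-dec ¬? (v ∈? component x)

  Leaves-sym : ∀ {x v} → Leaves x v → Leaves v x
  Leaves-sym {x} {v} (e , v∉) = adj-sym G e ,
    λ x∈ → v∉ (subst (v ∈_) (sym (component≡ (component∈ v) x∈)) (∈component v))

  transfer : V → V → ℕ
  transfer x v = w x * 𝟙 (leaves? x v)

  -- `outflow x` is what `x` pulls in, to the benefit of its component; `inflow v` is what `v` has
  -- to give.
  inflow outflow outside : V → ℕ
  inflow  v = ∑ (λ x → transfer x v) (allFin n)
  outflow x = ∑ (transfer x) (allFin n)
  outside x = ∑ (λ v → 𝟙 (leaves? x v)) (allFin n)

  inside : List V → V → ℕ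
  inside C x = ∑ (λ v → 𝟙 (adj? G x v)) C

  outflow≡ : ∀ x → outflow x ≡ w x * outside x
  outflow≡ x = ∑-*ˡ (w x) _ (allFin n)

  inside+outside : ∀ {C x} → C ∈ css → x ∈ C → inside C x + outside x ≡ 5
  inside+outside {C} {x} C∈ x∈ = begin
    inside C x + outside x                  ≡⟨ cong (inside C x +_) outside≡ ⟩
    inside C x + ∑ (λ v → 𝟙 (adj? G x v)) D ≡⟨ ∑-++ _ C D ⟨
    ∑ (λ v → 𝟙 (adj? G x v)) (C ++ D)       ≡⟨ ∑-↭ _ σ ⟨
    ∑ (λ v → 𝟙 (adj? G x v)) (allFin n)     ≡⟨ length-filter-∑ (adj? G x) (allFin n) ⟨
    degree G x                              ≡⟨ regular x ⟩
    5                                       ∎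
    where
    open ≡-Reasoning
    D = concat (proj₁ (extract C∈))
    σ : allFin n ↭ C ++ D
    σ = ↭-trans (↭-sym (proj₂ part)) (concat-↭ (proj₂ (extract C∈)))
    D-disjoint : ∀ {v} → v ∈ C → v ∉ D
    D-disjoint = proj₂ (proj₂ (Unique-++ C (Unique-resp-↭ σ (allFin⁺ n))))
    ≡C : component x ≡ C
    ≡C = component≡ C∈ x∈
    outside≡ : outside x ≡ ∑ (λ v → 𝟙 (adj? G x v)) D
    outside≡ = begin
      outside x ≡⟨ ∑-↭ _ σ ⟩
      ∑ (λ v → 𝟙 (leaves? x v)) (C ++ D) ≡⟨ ∑-++ _ C D ⟩
      ∑ (λ v → 𝟙 (leaves? x v)) C + ∑ (λ v → 𝟙 (leaves? x v)) D
        ≡⟨ cong₂ _+_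
             (∑-zero C λ {v} v∈ → 𝟙-no (leaves? x v) λ (_ , v∉) → v∉ (subst (v ∈_) (sym ≡C) v∈))
             (∑-cong D λ {v} v∈ → ≤-antisym
               (𝟙-mono (leaves? x v) (adj? G x v) proj₁)
               (𝟙-mono (adj? G x v) (leaves? x v) λ e → e , λ v∈C → D-disjoint (subst (v ∈_) ≡C v∈C) v∈)) ⟩
      ∑ (λ v → 𝟙 (adj? G x v)) D ∎

  -- Summed over all components, inflow and outflow are the same double sum over pairs of vertices
  -- and cancel.
  conclude : (∀ {C} → C ∈ css → 19 + ∑ inflow C ≤ 3 * length C + ∑ outflow C) →
    19 * length css ≤ 3 * n
  conclude balanced = linear (∑ inflow (allFin n))
    (subst₂ _≤_ (∑-+ (λ _ → 19) (∑ inflow) css) (∑-+ (λ C → 3 * length C) (∑ outflow) css) (∑-mono css balanced))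
    (cong₂ _+_ (trans (∑-const 19 css) (*-comm (length css) 19)) (total inflow))
    (cong₂ _+_ (trans (∑-*ˡ 3 length css) (cong (3 *_) (trans (∑-length css)
                 (trans (↭-length (proj₂ part)) (length-tabulate {n = n} (λ x → x))))))
      (trans (total outflow) (∑-swap transfer (allFin n) (allFin n))))
    where
    total : ∀ f → ∑ (∑ f) css ≡ ∑ f (allFin n)
    total f = trans (sym (∑-concat f css)) (∑-↭ f (proj₂ part))

  Source : V → V → Set
  Source v x = 0 < w x × Leaves x v

  transfer-source : ∀ {x v} → 0 < transfer x v → Source v x
  transfer-source {x} {v} pos with leaves? x v
  ... | yes l = subst (0 <_) (*-identityʳ (w x)) pos , l
  ... | no _  = contradiction (*-zeroʳ (w x)) (>⇒≢ pos)

  inflow-source : ∀ {v} → 0 < inflow v → ∃ (Source v)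
  inflow-source {v} pos =
    let x , _ , pos′ = ∑-pos (λ x → transfer x v) (allFin n) pos in x , transfer-source pos′

  source-endable : ∀ {v x} → Source v x → Endable x (component x)
  source-endable {x = x} (pos , _) = weight-endable (component∈ x) (∈component x) pos

  -- A source can be made an end of its own component, so its edge to `v` would merge the two
  -- components.
  inflow≡0 : ∀ {C v} → C ∈ css → v ∈ C → Endable v C → inflow v ≡ 0
  inflow≡0 {C} {v} C∈ v∈ ve with inflow v in eq
  ... | zero  = refl
  ... | suc _ = ⊥-elim (
    let x , src@(_ , e , v∉) = inflow-source {v} (subst (0 <_) (sym eq) (s≤s z≤n)) in
    no-merge opt (component∈ x) C∈ (λ { refl → v∉ v∈ }) (source-endable src) ve e)

  inflow≤ : ∀ {v} k → (∀ {x} → Source v x → w x ≤ k) → inflow v ≤ k * outside v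
  inflow≤ {v} k h = ≤-trans (∑-mono (allFin n) λ {x} _ → bound x) (≤-reflexive (∑-*ˡ k _ (allFin n)))
    where
    bound : ∀ x → transfer x v ≤ k * 𝟙 (leaves? v x)
    bound x with transfer x v in eq
    ... | zero  = z≤n
    ... | suc t with src@(_ , l) ← transfer-source {x} {v} (subst (0 <_) (sym eq) (s≤s z≤n)) =
      ≤-trans (≤-reflexive (sym eq)) (*-mono-≤ (h src) (𝟙-mono (leaves? x v) (leaves? v x) Leaves-sym))

  Balanced : List V → Set
  Balanced C = 19 + ∑ inflow C ≤ 3 * length C + ∑ outflow C

  weight≡ : ∀ {C x} → C ∈ css → x ∈ C → w x ≡ weight C x
  weight≡ {x = x} C∈ x∈ = cong (λ D → weight D x) (component≡ C∈ x∈)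

  -- Components that are cycles.

  module ClosedComponent {C : List V} (C∈ : C ∈ css) (cl : Closed C) where

    no-inflow : ∑ inflow C ≡ 0
    no-inflow = ∑-zero C λ v∈ → inflow≡0 C∈ v∈ (closed-endable (proj₂ (proj₂ (walk C∈))) cl v∈)

    -- Since `x` is not its own neighbour, at most `length C` - 1 of its five neighbours lie in `C`.
    6∸c≤outside : ∀ {x} → x ∈ C → 6 ∸ length C ≤ outside x
    6∸c≤outside {x} x∈ = m≤n+o⇒m∸n≤o 6 (length C) (subst (_≤ length C + outside x)
      (cong suc (inside+outside C∈ x∈))
      (+-monoˡ-≤ (outside x) (∑-miss (λ v → 𝟙 (adj? G x v)) (λ v → 𝟙≤1 (adj? G x v)) x∈ (𝟙-no (adj? G x x) (loopless G x)))))

    outflow-bound : ∀ {k} → (∀ {x} → x ∈ C → weight C x ≡ k) → length C * (k * (6 ∸ length C)) ≤ ∑ outflow C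
    outflow-bound {k} h = ≤-trans (≤-reflexive (sym (∑-const _ C))) (∑-mono C λ {x} x∈ →
      ≤-trans (*-monoʳ-≤ k (6∸c≤outside x∈))
        (≤-reflexive (trans (cong (_* outside x) (sym (trans (weight≡ C∈ x∈) (h x∈)))) (sym (outflow≡ x)))))

    long-outflow : 3 < length C → ∀ {x} → x ∈ C → outflow x ≡ outside x
    long-outflow lt {x} x∈ = trans (outflow≡ x) (trans
      (cong (_* outside x) (trans (weight≡ C∈ x∈) (weight-long C x cl lt))) (*-identityˡ (outside x)))

    -- With no edge leaving `C`, each vertex has its five neighbours among the five others, which
    -- would be a `K₆`.
    complete₆ : length C ≡ 6 → (∀ {x} → x ∈ C → outside x ≡ 0) → ⊥
    complete₆ len none = noK₆ (subst (λ k → Copy (complete k) G) len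
      (clique-copy G C (component-unique part C∈) adjacent))
      where
      adjacent : ∀ {x y} → x ∈ C → y ∈ C → x ≢ y → x ~ y
      adjacent {x} {y} x∈ y∈ x≢y = decidable-stable (adj? G x y) λ ≁ →
        let D , σ = extract x∈
            f = λ v → 𝟙 (adj? G x v)
            inside≡5 : inside C x ≡ 5
            inside≡5 = trans (sym (+-identityʳ _)) (trans (cong (inside C x +_) (sym (none x∈))) (inside+outside C∈ x∈))
            ∑D≡5 : ∑ f D ≡ 5
            ∑D≡5 = trans (cong (_+ ∑ f D) (sym (𝟙-no (adj? G x x) (loopless G x)))) (trans (sym (∑-↭ f σ)) inside≡5)
            6≤D = subst (λ k → suc k ≤ length D) ∑D≡5
              (∑-miss f (λ v → 𝟙≤1 (adj? G x v)) (∈-∷⁻ (x≢y ∘ sym) (∈-resp-↭ σ y∈)) (𝟙-no (adj? G x y) ≁))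
        in <⇒≱ 6≤D (≤-reflexive (suc-injective (trans (sym (↭-length σ)) len)))

    leaving : length C ≡ 6 → 1 ≤ ∑ outflow C
    leaving len = case any? (λ x → 1 ≤? outside x) C of λ where
      (yes some) → let x , x∈ , pos = find some in
        ≤-trans (subst (1 ≤_) (sym (long-outflow (subst (3 <_) (sym len) (m≤m+n 4 2)) x∈)) pos) (∑-∈ outflow x∈)
      (no none) → ⊥-elim (complete₆ len λ {x} x∈ → n<1⇒n≡0 (≰⇒> λ pos → none (lose x∈ pos)))

    balanced : Balanced C
    balanced = subst (λ k → 19 + k ≤ 3 * length C + ∑ outflow C) (sym no-inflow)
      (by-length (length C) refl (2≤component opt C∈))
      where
      short : length C ≤ 3 → 19 ≤ 3 * length C + length C * (2 * (6 ∸ length C)) →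
        19 ≤ 3 * length C + ∑ outflow C
      short le h = ≤-trans h (+-monoʳ-≤ (3 * length C) (outflow-bound λ {x} _ → weight-short C x cl le))
      long : 3 < length C → 19 ≤ 3 * length C + length C * (1 * (6 ∸ length C)) →
        19 ≤ 3 * length C + ∑ outflow C
      long lt h = ≤-trans h (+-monoʳ-≤ (3 * length C) (outflow-bound λ {x} _ → weight-long C x cl lt))
      by-length : ∀ c → length C ≡ c → 2 ≤ c → 19 ≤ 3 * length C + ∑ outflow C
      by-length 1 len (s≤s ())
      -- The bound 3c + w c (6 - c) is 22, 27, 20, 20 for c = 2, 3, 4, 5. For c = 6 it is only 18,
      -- and an edge leaving `C` supplies the missing 1; from c = 7 on, 3c suffices.
      by-length 2 len _ = short (subst (_≤ 3) (sym len) (m≤m+n 2 1)) (subst (λ c → 19 ≤ 3 * c + c * (2 * (6 ∸ c))) (sym len) (m≤m+n 19 3))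
      by-length 3 len _ = short (subst (_≤ 3) (sym len) ≤-refl) (subst (λ c → 19 ≤ 3 * c + c * (2 * (6 ∸ c))) (sym len) (m≤m+n 19 8))
      by-length 4 len _ = long (subst (3 <_) (sym len) ≤-refl) (subst (λ c → 19 ≤ 3 * c + c * (1 * (6 ∸ c))) (sym len) (m≤m+n 19 1))
      by-length 5 len _ = long (subst (3 <_) (sym len) (m≤m+n 4 1)) (subst (λ c → 19 ≤ 3 * c + c * (1 * (6 ∸ c))) (sym len) (m≤m+n 19 1))
      by-length 6 len _ = ≤-trans (≤-reflexive (cong (λ c → 3 * c + 1) (sym len))) (+-monoʳ-≤ (3 * length C) (leaving len))
      by-length (suc (suc (suc (suc (suc (suc (suc c))))))) len _ =
        ≤-trans (≤-trans (m≤m+n 19 2) (*-monoʳ-≤ 3 (subst (7 ≤_) (sym len) (m≤m+n 7 c)))) (m≤m+n (3 * length C) _)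

  -- Receivers in consecutive positions.

  end-to-end : ∀ {C x y} → C ∈ css → ¬ (Closed C × 3 < length C) → x ∈ C → y ∈ C → x ≢ y →
    0 < weight C x → 0 < weight C y → ∃ λ c → Walk x y c × c ↭ C
  end-to-end {C} {x} {y} C∈ small x∈ y∈ x≢y posx posy = join (closed? C)
    where
    -- On a cycle with at most three vertices any two are consecutive, so the cycle can be opened
    -- between them.
    triangle : ∀ {C u v} → Walk u v C → v ~ u → length C ≤ 3 → x ∈ C → y ∈ C → ∃ λ c → Walk x y c × c ↭ C
    triangle a l le (here refl) (here refl) = contradiction refl x≢y
    triangle ([ _ ]) l le (here refl) (there ())
    triangle (e ∷ [ _ ]) l le (here refl) (there (here refl)) = _ , e ∷ [ _ ] , ↭-refl
    triangle (e ∷ [ _ ]) l le (there (here refl)) (here refl) = _ , l ∷ [ _ ] , swap _ _ ↭-refl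
    triangle (e ∷ [ _ ]) l le (there (here refl)) (there (here refl)) = contradiction refl x≢y
    triangle (e ∷ f ∷ [ _ ]) l le (here refl) (there (here refl)) =
      _ , adj-sym G l ∷ adj-sym G f ∷ [ _ ] , prep _ (swap _ _ ↭-refl)
    triangle (e ∷ f ∷ [ _ ]) l le (here refl) (there (there (here refl))) = _ , e ∷ f ∷ [ _ ] , ↭-refl
    triangle (e ∷ f ∷ [ _ ]) l le (there (here refl)) (here refl) =
      _ , f ∷ l ∷ [ _ ] , ++-comm (_ ∷ _ ∷ []) (_ ∷ [])
    triangle (e ∷ f ∷ [ _ ]) l le (there (here refl)) (there (here refl)) = contradiction refl x≢y
    triangle (e ∷ f ∷ [ _ ]) l le (there (here refl)) (there (there (here refl))) =
      _ , adj-sym G e ∷ adj-sym G l ∷ [ _ ] , swap _ _ ↭-refl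
    triangle (e ∷ f ∷ [ _ ]) l le (there (there (here refl))) (here refl) =
      _ , adj-sym G f ∷ adj-sym G e ∷ [ _ ] , ↭-reverse (_ ∷ _ ∷ _ ∷ [])
    triangle (e ∷ f ∷ [ _ ]) l le (there (there (here refl))) (there (here refl)) =
      _ , l ∷ e ∷ [ _ ] , ++-comm (_ ∷ []) (_ ∷ _ ∷ [])
    triangle (e ∷ f ∷ [ _ ]) l le (there (there (here refl))) (there (there (here refl))) = contradiction refl x≢y
    triangle (e ∷ f ∷ g ∷ [ _ ]) l (s≤s (s≤s (s≤s ()))) _ _
    triangle (e ∷ f ∷ g ∷ h ∷ _) l (s≤s (s≤s (s≤s ()))) _ _

    join : Dec (Closed C) → ∃ λ c → Walk x y c × c ↭ C
    join (yes cl) = triangle (proj₂ (proj₂ (walk C∈))) (Closed-walk (proj₂ (proj₂ (walk C∈))) cl) (≮⇒≥ λ lt → small (cl , lt)) x∈ y∈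
    -- In an open component only the two ends have positive weight.
    join (no ¬cl) with _ , _ , a ← walk C∈ with weight-end a ¬cl posx | weight-end a ¬cl posy
    ... | inj₁ refl | inj₁ refl = contradiction refl x≢y
    ... | inj₁ refl | inj₂ refl = _ , a , ↭-refl
    ... | inj₂ refl | inj₁ refl = _ , reverseʷ a , ↭-reverse _
    ... | inj₂ refl | inj₂ refl = contradiction refl x≢y

  inflow-from-one : ∀ {v y} → (∀ {x} → Source v x → x ≡ y) → inflow v ≤ 2
  inflow-from-one {v} {y} one = ≤-trans (∑-mono (allFin n) λ {x} _ → bound x)
    (≤-trans (≤-reflexive (∑-*ˡ 2 (λ x → 𝟙 (x ≟ y)) (allFin n)))
      (*-monoʳ-≤ 2 (Unique-∑≤1 (_≟ y) (allFin⁺ n) λ p q → trans p (sym q))))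
    where
    bound : ∀ x → transfer x v ≤ 2 * 𝟙 (x ≟ y)
    bound x with transfer x v in eq
    ... | zero  = z≤n
    ... | suc t with src ← transfer-source {x} {v} (subst (0 <_) (sym eq) (s≤s z≤n)) =
      ≤-trans (≤-reflexive (sym eq)) (*-mono-≤ (weight≤2 (component x) x)
        (≤-trans (𝟙≤1 (leaves? x v)) (≤-reflexive (sym (𝟙-yes (x ≟ y) (one src))))))

  -- By `no-double-merge`, all sources of `u` and `v` lie in one component. If it is a long cycle,
  -- each source weighs 1, which gives the first alternative; otherwise `no-insertion` leaves a
  -- single common source, of weight at most 2.
  consecutive-receivers : ∀ p {u v q} → (p ++ u ∷ v ∷ q) ∈ css → 0 < inflow u → 0 < inflow v →
    (inflow u ≤ outside u × inflow v ≤ outside v) ⊎ (inflow u ≤ 2 × inflow v ≤ 2)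
  consecutive-receivers p {u} {v} {q} P∈ posu posv = by-kind (closed? C ×-dec (3 <? length C))
    where
    P : List V
    P = p ++ u ∷ v ∷ q

    u∈ : u ∈ P
    u∈ = ∈-++⁺ʳ p (here refl)

    v∈ : v ∈ P
    v∈ = ∈-++⁺ʳ p (there (here refl))

    elsewhere : ∀ {x z} → z ∈ P → Source z x → component x ≢ P
    elsewhere z∈ (_ , _ , z∉) eq = z∉ (subst (_ ∈_) (sym eq) z∈)

    shared : ∀ {x y} → Source u x → Source v y → component y ≡ component x
    shared {x} {y} sx sy = decidable-stable (≡-dec _≟_ (component y) (component x)) λ y≢x →
      no-double-merge opt p P∈ (component∈ x) (component∈ y) (elsewhere u∈ sx) (elsewhere v∈ sy) y≢x
        (source-endable sx) (source-endable sy) (proj₁ (proj₂ sx)) (proj₁ (proj₂ sy))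

    x₀ = proj₁ (inflow-source posu)
    y₀ = proj₁ (inflow-source posv)
    sx₀ = proj₂ (inflow-source posu)
    sy₀ = proj₂ (inflow-source posv)

    C : List V
    C = component x₀

    ≡C-u : ∀ {x} → Source u x → component x ≡ C
    ≡C-u sx = trans (sym (shared sx sy₀)) (shared sx₀ sy₀)

    ≡C-v : ∀ {y} → Source v y → component y ≡ C
    ≡C-v sy = shared sx₀ sy

    same-source : ¬ (Closed C × 3 < length C) → ∀ {x y} → Source u x → Source v y → x ≡ y
    same-source small {x} {y} sx sy = decidable-stable (x ≟ y) λ x≢y →
      let _ , a , σ = end-to-end (component∈ x₀) small
            (subst (x ∈_) (≡C-u sx) (∈component x)) (subst (y ∈_) (≡C-v sy) (∈component y)) x≢y
            (subst (λ D → 0 < weight D x) (≡C-u sx) (proj₁ sx))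
            (subst (λ D → 0 < weight D y) (≡C-v sy) (proj₁ sy))
      in no-insertion opt p P∈ (component∈ x₀) (elsewhere u∈ sx₀) a σ (proj₁ (proj₂ sx)) (proj₁ (proj₂ sy))

    by-kind : Dec (Closed C × 3 < length C) →
      (inflow u ≤ outside u × inflow v ≤ outside v) ⊎ (inflow u ≤ 2 × inflow v ≤ 2)
    by-kind (yes (cl , lt)) = inj₁
      ( subst (inflow u ≤_) (*-identityˡ (outside u)) (inflow≤ 1 λ {x} sx →
          ≤-reflexive (trans (cong (λ D → weight D x) (≡C-u sx)) (weight-long C x cl lt)))
      , subst (inflow v ≤_) (*-identityˡ (outside v)) (inflow≤ 1 λ {y} sy →
          ≤-reflexive (trans (cong (λ D → weight D y) (≡C-v sy)) (weight-long C y cl lt))))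
    by-kind (no small) = inj₂
      ( inflow-from-one (λ sx → same-source small sx sy₀)
      , inflow-from-one (λ sy → sym (same-source small sx₀ sy)))

  -- Components that are open paths.

  module OpenComponent {P : List V} (P∈ : P ∈ css) (¬cl : ¬ Closed P) {a b : V} (ab : Walk a b P)
    (s t : V) (second : ∀ {u v q} → P ≡ u ∷ v ∷ q → v ≡ s)
    (penultimate : ∀ p {v x} → P ≡ p ++ v ∷ x ∷ [] → v ≡ t) where

    α? : ∀ v → Dec (a ~ v × v ≢ s)
    α? v = adj? G a v ×-dec ¬? (v ≟ s)

    β? : ∀ v → Dec (b ~ v × v ≢ t)
    β? v = adj? G b v ×-dec ¬? (v ≟ t)

    -- The edges of the path itself are left out, whence the conditions on s and t.
    α β : V → ℕ
    α v = 𝟙 (α? v)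
    β v = 𝟙 (β? v)

    open Scan inflow α β

    start-inflow : inflow a ≡ 0
    start-inflow = inflow≡0 P∈ (Walk-start∈ ab) (_ , _ , ab , ↭-refl)

    end-inflow : inflow b ≡ 0
    end-inflow = inflow≡0 P∈ (Walk-end∈ ab) (_ , _ , reverseʷ ab , ↭-reverse P)

    -- Of the five edges at `v`, two go to `u` and `x`. If `α v` or `β v` counts, then `a` in `p` or
    -- `b` in `q` is a further neighbour inside the path.
    interior : ∀ p {u v x q} → P ≡ p ++ u ∷ v ∷ x ∷ q → outside v + (α v + β v) ≤ 3
    interior p {u} {v} {x} {q} refl with w₁ , u~v , v~x′ ∷ w₂ ← cut p ab with refl ← Walk-head w₂ =
      +-cancelʳ-≤ 2 _ 3 (begin
        outside v + (α v + β v) + 2             ≤⟨ +-monoˡ-≤ 2 (+-monoʳ-≤ (outside v) (+-mono-≤ α≤ β≤)) ⟩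
        outside v + (∑ f p + ∑ f q) + 2         ≤⟨ m≤m+n _ (f v) ⟩
        outside v + (∑ f p + ∑ f q) + 2 + f v   ≡⟨ rearrange (outside v) (∑ f p) (∑ f q) (f v) ⟩
        ∑ f p + (1 + (f v + (1 + ∑ f q))) + outside v
          ≡⟨ cong₂ (λ j k → ∑ f p + (j + (f v + (k + ∑ f q))) + outside v)
               (𝟙-yes (adj? G v u) (adj-sym G u~v)) (𝟙-yes (adj? G v x) v~x′) ⟨
        ∑ f p + ∑ f (u ∷ v ∷ x ∷ q) + outside v ≡⟨ cong (_+ outside v) (∑-++ f p (u ∷ v ∷ x ∷ q)) ⟨
        inside P v + outside v                  ≡⟨ inside+outside P∈ (∈-++⁺ʳ p (there (here refl))) ⟩
        5                                       ∎)
      where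
      open ≤-Reasoning
      f : V → ℕ
      f y = 𝟙 (adj? G v y)
      rearrange : ∀ o c d e → o + (c + d) + 2 + e ≡ c + (1 + (e + (1 + d))) + o
      rearrange = solve-∀
      neighbour : ∀ {y} {c : List V} → y ~ v → y ∈ c → 1 ≤ ∑ f c
      neighbour {y} y~v y∈ = ≤-trans (≤-reflexive (sym (𝟙-yes (adj? G v y) (adj-sym G y~v)))) (∑-∈ f y∈)
      before-u : ∀ p → P ≡ p ++ u ∷ v ∷ x ∷ q → a ~ v × v ≢ s → a ∈ p
      before-u []      eq (_ , v≢s) = contradiction (second eq) v≢s
      before-u (_ ∷ p) eq _         = here (Walk-head (subst (Walk a b) eq ab))
      after-x : ∀ q → P ≡ p ++ u ∷ v ∷ x ∷ q → Walk x b (x ∷ q) → b ~ v × v ≢ t → b ∈ q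
      after-x [] eq _ (_ , v≢t) =
        contradiction (penultimate (p ∷ʳ u) (trans eq (sym (++-assoc p (u ∷ []) (v ∷ x ∷ []))))) v≢t
      after-x (_ ∷ _) eq (_ ∷ c) _ = Walk-end∈ c
      α≤ : α v ≤ ∑ f p
      α≤ with α? v
      ... | yes h@(a~v , _) = neighbour a~v (before-u p refl h)
      ... | no _            = z≤n
      β≤ : β v ≤ ∑ f q
      β≤ with β? v
      ... | yes h@(b~v , _) = neighbour b~v (after-x q refl w₂ h)
      ... | no _            = z≤n

    receiver : ∀ p {v q} → P ≡ p ++ v ∷ q → 0 < inflow v → outside v + (α v + β v) ≤ 3
    receiver p {v} {q} eq pos with initLast p
    ... | [] with refl ← Walk-head (subst (Walk a b) eq ab) = contradiction start-inflow (>⇒≢ pos)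
    receiver .(p ∷ʳ u) {v} {[]} eq pos | p ∷ʳ′ u
      with _ , [ _ ] ← splitAt (p ∷ʳ u) (subst (Walk a b) eq ab) = contradiction end-inflow (>⇒≢ pos)
    receiver .(p ∷ʳ u) {v} {x ∷ q} eq pos | p ∷ʳ′ u =
      interior p (trans eq (++-assoc p (u ∷ []) (v ∷ x ∷ q)))

    receiver-load : ∀ p {v q} → P ≡ p ++ v ∷ q → 0 < inflow v → load v ≤ 6
    receiver-load p {v} eq pos = ≤-trans
      (+-monoˡ-≤ (2 * (α v + β v)) (inflow≤ 2 λ {x} _ → weight≤2 (component x) x))
      (subst (_≤ 6) (*-distribˡ-+ 2 (outside v) (α v + β v)) (*-monoʳ-≤ 2 (receiver p eq pos)))

    step : ∀ p {u v q} → P ≡ p ++ u ∷ v ∷ q → Step u v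
    step p {u} {v} {q} refl with w₁ , u~v , w₂ ← cut p ab = record
      { back = back ; forth = forth ; cross = cross ; bound = receiver-load (p ∷ʳ u) eq′ ; run = run }
      where
      eq′ : p ++ u ∷ v ∷ q ≡ p ∷ʳ u ++ v ∷ q
      eq′ = sym (++-assoc p (u ∷ []) (v ∷ q))

      -- If `a ~ v`, reversing the part up to `u` gives a Hamiltonian path that starts at `u`.
      back : α v ≡ 0 ⊎ inflow u ≡ 0
      back with 𝟙-cases (α? v)
      ... | inj₁ αv        = inj₁ αv
      ... | inj₂ (a~v , _) = inj₂ (inflow≡0 P∈ (∈-++⁺ʳ p (here refl))
        (_ , _ , reverseʷ w₁ ⟨ a~v ⟩ w₂ ,
         ↭-trans (++⁺ʳ (v ∷ q) (↭-reverse (p ∷ʳ u))) (↭-reflexive (sym eq′))))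

      -- Symmetrically, `b ~ u` gives a Hamiltonian path that starts at `v`.
      forth : β u ≡ 0 ⊎ inflow v ≡ 0
      forth with 𝟙-cases (β? u)
      ... | inj₁ βu        = inj₁ βu
      ... | inj₂ (b~u , _) = inj₂ (inflow≡0 P∈ (∈-++⁺ʳ p (there (here refl)))
        (_ , _ , w₂ ⟨ b~u ⟩ reverseʷ w₁ ,
         ↭-trans (++-comm (v ∷ q) (reverse (p ∷ʳ u)))
           (↭-trans (++⁺ʳ (v ∷ q) (↭-reverse (p ∷ʳ u))) (↭-reflexive (sym eq′)))))

      -- The two edges together would turn `P` into a cycle and lower the cost from 5 to 4.
      not-both : a ~ v → ¬ b ~ u
      not-both a~v b~u = no-improvement opt (P ∷ []) ((p ∷ʳ u ++ reverse (v ∷ q)) ∷ []) (proj₂ (extract P∈))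
        ((_ , _ , cycle) ∷ [])
        (++⁺ʳ [] (↭-trans (++⁺ˡ (p ∷ʳ u) (↭-reverse (v ∷ q))) (↭-reflexive (sym eq′))))
        (subst₂ (λ j k → j + 0 < k + 0)
          (sym (cost-closed {c = p ∷ʳ u ++ reverse (v ∷ q)} (++-length w₁ (reverseʷ w₂)) (Walk-closed cycle (adj-sym G a~v))))
          (sym (cost-open {c = P} (2≤component opt P∈) ¬cl)) ≤-refl)
        where
        cycle : Walk a v (p ∷ʳ u ++ reverse (v ∷ q))
        cycle = w₁ ⟨ adj-sym G b~u ⟩ reverseʷ w₂

      cross : α v ≡ 0 ⊎ β u ≡ 0
      cross with 𝟙-cases (α? v) | 𝟙-cases (β? u)
      ... | inj₁ αv        | _              = inj₁ αv
      ... | inj₂ _         | inj₁ βu        = inj₂ βu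
      ... | inj₂ (a~v , _) | inj₂ (b~u , _) = ⊥-elim (not-both a~v b~u)

      light-outside : ∀ {z} → inflow z ≤ outside z → outside z + (α z + β z) ≤ 3 → load z ≤ 3 + (α z + β z)
      light-outside {z} i≤ o≤ = ≤-trans (+-monoˡ-≤ _ i≤)
        (≤-trans (≤-reflexive (lem (outside z) (α z + β z))) (+-monoˡ-≤ (α z + β z) o≤))
        where
        lem : ∀ o k → o + 2 * k ≡ o + k + k
        lem = solve-∀

      -- With k = `α z + β z` at most 1, the load is at most 2 + 2k, hence at most 3 + k.
      light-single : ∀ {z} → inflow z ≤ 2 → α z + β z ≤ 1 → load z ≤ 3 + (α z + β z)
      light-single {z} i≤ k≤ = ≤-trans (+-mono-≤ i≤ (≤-trans (≤-reflexive (lem (α z + β z))) (+-monoˡ-≤ (α z + β z) k≤)))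
        ≤-refl
        where
        lem : ∀ k → 2 * k ≡ k + k
        lem = solve-∀

      run : 0 < inflow u → 0 < inflow v → load u ≤ 3 + (α u + β u) × load v ≤ 3 + (α v + β v)
      run posu posv with consecutive-receivers p P∈ posu posv
      ... | inj₁ (iu , iv) = light-outside iu (receiver p refl posu) , light-outside iv (receiver (p ∷ʳ u) eq′ posv)
      ... | inj₂ (iu , iv) = light-single iu (αβu forth) , light-single iv (αβv back)
        where
        αβu : β u ≡ 0 ⊎ inflow v ≡ 0 → α u + β u ≤ 1
        αβu (inj₁ βu) = subst (λ k → α u + k ≤ 1) (sym βu) (subst (_≤ 1) (sym (+-identityʳ (α u))) (𝟙≤1 (α? u)))
        αβu (inj₂ iv) = contradiction iv (>⇒≢ posv)
        αβv : α v ≡ 0 ⊎ inflow u ≡ 0 → α v + β v ≤ 1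
        αβv (inj₁ αv) = subst (λ k → k + β v ≤ 1) (sym αv) (𝟙≤1 (β? v))
        αβv (inj₂ iu) = contradiction iu (>⇒≢ posu)

    chain : ∀ p u vs → P ≡ p ++ u ∷ vs → Chain u vs
    chain p u [] eq with _ , [ _ ] ← splitAt p (subst (Walk a b) eq ab) =
      end-inflow , 𝟙-no (β? b) (loopless G b ∘ proj₁)
    chain p u (v ∷ vs) eq = step p eq , chain (p ∷ʳ u) v vs (trans eq (sym (++-assoc p (u ∷ []) (v ∷ vs))))

    -- The 1 stands for the path edge at an end `c`, whose other vertex `r` is left out of the
    -- count.
    ends-inside : ∀ c r (d : ∀ v → Dec (c ~ v × v ≢ r)) → inside P c ≤ ∑ (λ v → 𝟙 (d v)) P + 1
    ends-inside c r d = ≤-trans (∑-mono P λ {v} _ → pointwise v) (≤-trans (≤-reflexive (∑-+ _ _ P))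
      (+-monoʳ-≤ (∑ (λ v → 𝟙 (d v)) P)
        (Unique-∑≤1 (_≟ r) (component-unique part P∈) λ p q → trans p (sym q))))
      where
      pointwise : ∀ v → 𝟙 (adj? G c v) ≤ 𝟙 (d v) + 𝟙 (v ≟ r)
      pointwise v with v ≟ r
      ... | yes _  = ≤-trans (𝟙≤1 (adj? G c v)) (m≤n+m 1 (𝟙 (d v)))
      ... | no v≢r = ≤-trans (𝟙-mono (adj? G c v) (d v) (_, v≢r)) (m≤m+n _ 0)

    end-outflow : ∀ {c} → c ∈ ends P → c ∈ P → outflow c ≡ 2 * outside c
    end-outflow {c} c∈ c∈P = trans (outflow≡ c) (cong (_* outside c)
      (trans (weight≡ P∈ c∈P) (trans (weight-open P c ¬cl) (cong (2 *_) (𝟙-yes (c ∈? ends P) c∈)))))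

    -- The load of the first vertex is exactly the `2 * β a` reserved by `after-gap`, so its own 3
    -- remains for `balance`.
    total-load : ∀ vs → P ≡ a ∷ vs → ∑ load P ≤ 3 * length vs
    total-load vs eq = begin
      ∑ load P                 ≡⟨ cong (∑ load) eq ⟩
      load a + ∑ load vs       ≡⟨ cong (_+ ∑ load vs) (cong₂ (λ i k → i + 2 * (k + β a)) start-inflow
                                    (𝟙-no (α? a) (loopless G a ∘ proj₁))) ⟩
      2 * β a + ∑ load vs      ≤⟨ after-gap (λ v → 𝟙≤1 (α? v)) (λ v → 𝟙≤1 (β? v)) a vs start-inflow (chain [] a vs eq) ⟩
      3 * length vs            ∎
      where open ≤-Reasoning

    -- This is where 19 arises: ten edges at the two ends are worth 2 each, the two path edges among
    -- them lose 4, other inside edges are paid for by the load, and the 3 of the first vertex is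
    -- added: 20 - 4 + 3.
    balance : ∀ {I A B na nb oa ob O k} → I + 2 * (A + B) ≤ 3 * k → na ≤ A + 1 → nb ≤ B + 1 →
      na + oa ≡ 5 → nb + ob ≡ 5 → 2 * oa + 2 * ob ≤ O → 19 + I ≤ 3 * suc k + O
    balance {I} {A} {B} {na} {nb} {oa} {ob} {O} {k} h₁ h₂ h₃ h₄ h₅ h₆ = linear (1 + 2 * (A + B))
      (+-mono-≤ (+-mono-≤ h₁ h₆) (*-monoʳ-≤ 2 (+-mono-≤ h₂ h₃)))
      (trans (lem₁ I A B na nb oa ob)
        (trans (cong₂ (λ i j → I + 2 * (A + B) + 2 * (i + j)) h₄ h₅) (lem₂ I A B)))
      (lem₃ A B O k)
      where
      lem₁ : ∀ I A B na nb oa ob → I + 2 * (A + B) + (2 * oa + 2 * ob) + 2 * (na + nb) ≡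
        I + 2 * (A + B) + 2 * ((na + oa) + (nb + ob))
      lem₁ = solve-∀
      lem₂ : ∀ I A B → I + 2 * (A + B) + 2 * (5 + 5) ≡ 19 + I + (1 + 2 * (A + B))
      lem₂ = solve-∀
      lem₃ : ∀ A B O k → 3 * k + O + 2 * (A + 1 + (B + 1)) ≡ 3 * suc k + O + (1 + 2 * (A + B))
      lem₃ = solve-∀

    balanced : ∀ vs → P ≡ a ∷ vs → b ∈ vs → Balanced P
    balanced vs eq b∈ = subst (λ k → 19 + ∑ inflow P ≤ 3 * k + ∑ outflow P) (sym (cong length eq))
      (balance {A = ∑ α P} {∑ β P}
        (subst (_≤ 3 * length vs) load≡ (total-load vs eq))
        (ends-inside a s α?) (ends-inside b t β?)
        (inside+outside P∈ (Walk-start∈ ab)) (inside+outside P∈ (Walk-end∈ ab))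
        (begin
          2 * outside a + 2 * outside b ≡⟨ cong₂ _+_
            (end-outflow (subst (a ∈_) (sym (ends-walk ab)) (here refl)) (Walk-start∈ ab))
            (end-outflow (subst (b ∈_) (sym (ends-walk ab)) (there (here refl))) (Walk-end∈ ab)) ⟨
          -- As `b` lies in the tail `vs`, the outflows of the two ends are separate summands.
          outflow a + outflow b         ≤⟨ +-monoʳ-≤ (outflow a) (∑-∈ outflow b∈) ⟩
          outflow a + ∑ outflow vs      ≡⟨ cong (∑ outflow) eq ⟨
          ∑ outflow P                   ∎))
      where
      open ≤-Reasoning
      load≡ : ∑ load P ≡ ∑ inflow P + 2 * (∑ α P + ∑ β P)
      load≡ = trans (∑-+ inflow (λ v → 2 * (α v + β v)) P)
        (cong (∑ inflow P +_) (trans (∑-*ˡ 2 (λ v → α v + β v) P) (cong (2 *_) (∑-+ α β P))))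

  -- The second vertex `s` is read off the path, the penultimate vertex `t` off its reversal.
  open-balanced : ∀ {P} → P ∈ css → ¬ Closed P → Balanced P
  open-balanced {P} P∈ ¬cl = go P refl (proj₂ (proj₂ (walk P∈))) (2≤component opt P∈) (reverse P) refl
    where
    go : ∀ Q → P ≡ Q → ∀ {a b} → Walk a b Q → 2 ≤ length Q → ∀ R → reverse P ≡ R → Balanced P
    go (x ∷ []) refl _ (s≤s ()) R eqR
    go (a ∷ s ∷ c) refl ab@(_ ∷ ab′) _ [] eqR = contradiction
      (trans (sym (length-reverse P)) (cong length eqR)) λ ()
    go (a ∷ s ∷ c) refl ab@(_ ∷ ab′) _ (z ∷ []) eqR = contradiction
      (trans (sym (length-reverse P)) (cong length eqR)) λ ()
    go (a ∷ s ∷ c) refl ab@(_ ∷ ab′) _ (z ∷ t ∷ r) eqR = OpenComponent.balanced P∈ ¬cl ab s t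
      (λ eq → sym (∷-injectiveˡ (∷-injectiveʳ eq)))
      (λ p {v} {x} eq → ∷-injectiveˡ (∷-injectiveʳ
        (trans (sym (reverse-++ p (v ∷ x ∷ []))) (trans (cong reverse (sym eq)) eqR))))
      (s ∷ c) refl (Walk-end∈ ab′)

-- Bounded search and conversion into path partitions.

module Search {n} (G : Graph n) where
  open Walks G
  open Partitions G

  -- The choice of a minimal partition is classical; Witness is decidable and
  -- bounded, so that it can be made under a double negation.
  Witness : List (List V) → Set
  Witness css = All (_≢ []) css × All (Linked (Adj G)) css × Unique (concat css) ×
    All (_∈ concat css) (allFin n) × 19 * length css ≤ 3 * n

  nonempty? : (c : List V) → Dec (c ≢ [])
  nonempty? []      = no λ ≢ → ≢ refl
  nonempty? (_ ∷ _) = yes λ ()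

  witness? : ∀ css → Dec (Witness css)
  witness? css = all? nonempty? css ×-dec all? (linked? (adj? G)) css ×-dec unique? _≟_ (concat css) ×-dec
    all? (_∈? concat css) (allFin n) ×-dec (19 * length css ≤? 3 * n)

  -- Nonempty disjoint components number at most `n` and have at most `n` vertices each, so the
  -- search is finite.
  witness-bounded : ∀ {css} → Witness css → css ∈ listsUpTo n (listsUpTo n (allFin n))
  witness-bounded {css} (ne , _ , u , _) = ∈-listsUpTo
    (≤-trans (≤-trans (≤-reflexive (trans (sym (*-identityʳ (length css))) (sym (∑-const 1 css))))
      (∑-mono css λ c∈ → positive (All.lookup ne c∈))) total)
    λ c∈ → ∈-listsUpTo (≤-trans (∑-∈ length c∈) total) λ {x} _ → ∈-allFin x
    where
    total : ∑ length css ≤ n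
    total = subst₂ _≤_ (sym (∑-length css)) (length-tabulate {n = n} (λ x → x))
      (Unique-⊆-length u λ {x} _ → ∈-allFin x)
    positive : ∀ {c : List V} → c ≢ [] → 1 ≤ length c
    positive {[]}    ≢ = contradiction refl ≢
    positive {_ ∷ _} _ = s≤s z≤n

  search : Dec (∃ Witness)
  search = map′ (λ a → let css , _ , h = find a in css , h) (λ (css , h) → lose (witness-bounded h) h)
    (any? witness? (listsUpTo n (listsUpTo n (allFin n))))

  paths : ∀ css → All (_≢ []) css → All (Linked (Adj G)) css → Unique (concat css) →
    Σ[ ps ∈ List (Path G) ] map vertices ps ≡ css × AllPairs Disjoint css
  paths []        _          _        _ = [] , refl , []
  paths (c ∷ css) (ne ∷ nes) (l ∷ ls) u =
    let uc , ucss , disj = Unique-++ c u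
        ps , eq , pairs  = paths css nes ls ucss
    in record { vertices = c ; nonempty = ne ; linked = l ; unique = uc } ∷ ps , cong (c ∷_) eq ,
       All.tabulate (λ d∈ (x∈c , x∈d) → disj x∈c (∈-concat⁺′ x∈d d∈)) ∷ pairs

  witness-partition : ∀ {css} → Witness css → Σ[ 𝒫 ∈ PathPartition G ] 19 * size 𝒫 ≤ 3 * n
  witness-partition {css} (ne , l , u , cov , le) with ps , refl , pairs ← paths css ne l u =
    record
      { components = ps
      ; disjoint   = AllPairs.map⁻ pairs
      ; covers     = λ v → let _ , v∈ , c∈ = ∈-concat⁻′ css (All.lookup cov (∈-allFin v))
                           in Any.map⁻ (lose c∈ v∈)
      } , subst (λ k → 19 * k ≤ 3 * n) (length-map vertices ps) le

  Walk-linked : ∀ {x y c} → Walk x y c → Linked (Adj G) c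
  Walk-linked [ x ]             = [-]
  Walk-linked (e ∷ [ _ ])     = e ∷ [-]
  Walk-linked (e ∷ a@(_ ∷ _))   = e ∷ Walk-linked a

  Walk-nonempty : ∀ {x y c} → Walk x y c → c ≢ []
  Walk-nonempty [ x ]   ()
  Walk-nonempty (e ∷ a) ()

  partition-witness : ∀ {css} → IsPartition css → 19 * length css ≤ 3 * n → Witness css
  partition-witness part@(ps , σ) le =
    All.map (λ (_ , _ , a) → Walk-nonempty a) ps , All.map (λ (_ , _ , a) → Walk-linked a) ps ,
    partition-unique part , All.tabulate (λ {v} _ → ∈-resp-↭ (↭-sym σ) (∈-allFin v)) , le

-- Choice of a minimal partition and conclusion.

theorem2 : (n : ℕ) (G : Graph n) → Regular 5 G → ¬ Copy (complete 6) G →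
    Σ[ 𝒫 ∈ PathPartition G ] 19 * size 𝒫 ≤ 3 * n
theorem2 n G regular noK₆ = witness-partition (proj₂ (decidable-stable search λ none →
  -- Strong induction on the cost: without a witness no partition of cost `m` exists, because one
  -- with none cheaper would be minimal and thus yield a witness.
  <-rec (λ m → ∀ css → IsPartition css → ∑ cost css ≡ m → ⊥)
    (λ m smaller css part eq → none (css , partition-witness part
      (few-components css part λ dss part′ → ≮⇒≥ λ lt → smaller (subst (∑ cost dss <_) eq lt) dss part′ refl)))
    -- The partition into single vertices contradicts this.
    _ (map List.[_] (allFin n))
    (All.tabulate singleton-path , ↭-reflexive (concat-map-[_] (allFin n))) refl))
  where
  open Walks G
  open Search G

  singleton-path : ∀ {c} → c ∈ map List.[_] (allFin n) → IsPath c
  singleton-path c∈ with x , _ , refl ← ∈-map⁻ List.[_] c∈ = _ , _ , [ x ]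

  few-components : ∀ css → IsPartition css → (∀ dss → IsPartition dss → ∑ cost css ≤ ∑ cost dss) →
    19 * length css ≤ 3 * n
  few-components css part min = conclude balanced
    where
    opt : Minimal.Optimal (∑ cost css) min css
    opt = part , ≤-refl
    open Discharging G regular noK₆ (∑ cost css) min css opt
    balanced : ∀ {C} → C ∈ css → Balanced C
    balanced {C} C∈ with closed? C
    ... | yes cl = ClosedComponent.balanced C∈ cl
    ... | no ¬cl = open-balanced C∈ ¬cl
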